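{- Let $p\ge3$ be a prime and let $\mathbf{Q}_p(\sqrt d)$ be an unramified quadratic extension of $\mathbf{Q}_p$. Suppose $\lambda\in U^0(\sqrt d)$ has order $l$ modulo $p$, and let $k=\nu_p(\lambda^l-1)$. Then the closed subgroup of $U^0(\sqrt d)$ generated by $\lambda$ is $$\overline{\{\lambda^n:n\in\mathbf{N}\}}=\bigsqcup_{i=0}^{l-1}\left(\lambda^i+p^k\mathbf{Z}_p[\sqrt d]\right)\cap U^0(\sqrt d).$$ In particular, if $l=2(p+1)$ and $k=1$, then $\overline{\{\lambda^n:n\in\mathbf{N}\}}=U^0(\sqrt d)$.
   Context: Here $d\in\mathbf{Z}_p^*$ is a non-square, and $\mathbf{Z}_p[\sqrt d]$ is the ring of integers of $\mathbf{Q}_p(\sqrt d)$. The norm is $N(x+y\sqrt d)=x^2-y^2d$, and $U^0(\sqrt d)=\{z\in\mathbf{Z}_p[\sqrt d]^*: N(z)=\pm1\}$. The order of a unit $\lambda$ modulo $p$ is the least $l\ge1$ with $\lambda^l-1\in p\mathbf{Z}_p[\sqrt d]$. $\nu_p$ is the valuation on $\mathbf{Q}_p(\sqrt d)$ with $\nu_p(p)=1$. $\bigsqcup$ denotes disjoint union. -}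

module Defs where

open import Algebra.Bundles using (CommutativeRing)
import Algebra.Definitions as AlgebraicDefinitions
import Algebra.Properties.Semiring.Exp as SemiringExp
import Algebra.Solver.Ring.NaturalCoefficients.Default as SemiringSolver
open import Data.Integer.Base as ℤ using (ℤ; +_; 0ℤ; 1ℤ)
open import Data.Integer.Divisibility.Signed using (_∣_; divides; ∣m∣n⇒∣m+n; ∣m⇒∣-m; ∣n⇒∣m*n; ∣m⇒∣m*n)
import Data.Integer.Properties as ℤ
open import Data.Integer.Tactic.RingSolver using (solve-∀)
open import Data.Nat.Base as ℕ using (ℕ; suc; _≤_)
open import Data.Product.Base using (Σ-syntax; ∃-syntax; _×_; _,_)
open import Data.Sum.Base using (_⊎_)
open import Level using (Level; 0ℓ; _⊔_) renaming (suc to lsuc)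
open import Relation.Binary.PropositionalEquality.Core using (_≡_; refl)
open import Relation.Nullary.Construct.Add.Supremum using (_⁺; [_]; ⊤⁺)
open import Relation.Nullary.Negation.Core using (¬_)
open import Relation.Unary using (Pred; _∈_; _⊆_; _∩_)

private
  variable
    ℓ : Level

  subst-∣ : ∀ {m x y : ℤ} → x ≡ y → m ∣ y → m ∣ x
  subst-∣ refl m∣y = m∣y

------------------------------------------------------------------------
-- ℤₚ as the inverse limit of the rings ℤ / pⁿ: an element is a coherent
-- sequence of integers, the n-th one representing a class modulo pⁿ.

module PAdic (p : ℕ) where

  infix  4 _≡_[mod-p^_] _≈_
  infixl 6 _+_
  infixl 7 _*_
  infix  8 -_

  record _≡_[mod-p^_] (x y : ℤ) (n : ℕ) : Set where
    constructor mk≡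
    field
      p^n∣x-y : + (p ℕ.^ n) ∣ x ℤ.- y

  record ℤₚ : Set where
    constructor mkℤₚ
    field
      residue  : ℕ → ℤ
      coherent : ∀ n → residue (suc n) ≡ residue n [mod-p^ n ]

  open _≡_[mod-p^_] public
  open ℤₚ public

  record _≈_ (a b : ℤₚ) : Set where
    constructor mk≈
    field
      residue-≡ : ∀ n → residue a n ≡ residue b n [mod-p^ n ]

  open _≈_ public

  private
    abstract
      reflₚ : ∀ {n x y} → x ≡ y → x ≡ y [mod-p^ n ]
      reflₚ {x = x} refl = mk≡ (divides 0ℤ (ℤ.+-inverseʳ x))

      symₚ : ∀ {n x y} → x ≡ y [mod-p^ n ] → y ≡ x [mod-p^ n ]
      symₚ {x = x} {y} (mk≡ h) = mk≡ (subst-∣ (eq x y) (∣m⇒∣-m h))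
        where
        eq : ∀ x y → y ℤ.- x ≡ ℤ.- (x ℤ.- y)
        eq = solve-∀

      transₚ : ∀ {n x y z} → x ≡ y [mod-p^ n ] → y ≡ z [mod-p^ n ] →
               x ≡ z [mod-p^ n ]
      transₚ {x = x} {y} {z} (mk≡ h) (mk≡ k) =
        mk≡ (subst-∣ (eq x y z) (∣m∣n⇒∣m+n h k))
        where
        eq : ∀ x y z → x ℤ.- z ≡ (x ℤ.- y) ℤ.+ (y ℤ.- z)
        eq = solve-∀

      +-congₚ : ∀ {n x x′ y y′} → x ≡ x′ [mod-p^ n ] → y ≡ y′ [mod-p^ n ] →
                x ℤ.+ y ≡ x′ ℤ.+ y′ [mod-p^ n ]
      +-congₚ {x = x} {x′} {y} {y′} (mk≡ h) (mk≡ k) =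
        mk≡ (subst-∣ (eq x x′ y y′) (∣m∣n⇒∣m+n h k))
        where
        eq : ∀ x x′ y y′ →
             (x ℤ.+ y) ℤ.- (x′ ℤ.+ y′) ≡ (x ℤ.- x′) ℤ.+ (y ℤ.- y′)
        eq = solve-∀

      *-congₚ : ∀ {n x x′ y y′} → x ≡ x′ [mod-p^ n ] → y ≡ y′ [mod-p^ n ] →
                x ℤ.* y ≡ x′ ℤ.* y′ [mod-p^ n ]
      *-congₚ {x = x} {x′} {y} {y′} (mk≡ h) (mk≡ k) = mk≡
        (subst-∣ (eq x x′ y y′) (∣m∣n⇒∣m+n (∣m⇒∣m*n y h) (∣n⇒∣m*n x′ k)))
        where
        eq : ∀ x x′ y y′ →
             x ℤ.* y ℤ.- x′ ℤ.* y′ ≡ (x ℤ.- x′) ℤ.* y ℤ.+ x′ ℤ.* (y ℤ.- y′)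
        eq = solve-∀

      neg-congₚ : ∀ {n x y} → x ≡ y [mod-p^ n ] →
                  ℤ.- x ≡ ℤ.- y [mod-p^ n ]
      neg-congₚ {x = x} {y} (mk≡ h) = mk≡ (subst-∣ (eq x y) (∣m⇒∣-m h))
        where
        eq : ∀ x y → (ℤ.- x) ℤ.- (ℤ.- y) ≡ ℤ.- (x ℤ.- y)
        eq = solve-∀

  fromℤ : ℤ → ℤₚ
  fromℤ x = mkℤₚ (λ _ → x) (λ n → reflₚ refl)

  _+_ : ℤₚ → ℤₚ → ℤₚ
  a + b = mkℤₚ (λ n → residue a n ℤ.+ residue b n)
               (λ n → +-congₚ (coherent a n) (coherent b n))

  _*_ : ℤₚ → ℤₚ → ℤₚ
  a * b = mkℤₚ (λ n → residue a n ℤ.* residue b n)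
               (λ n → *-congₚ (coherent a n) (coherent b n))

  -_ : ℤₚ → ℤₚ
  - a = mkℤₚ (λ n → ℤ.- residue a n)
             (λ n → neg-congₚ (coherent a n))

  private
    pointwise : ∀ {a b} → (∀ n → residue a n ≡ residue b n) → a ≈ b
    pointwise h = mk≈ λ n → reflₚ (h n)

  ℤₚ-ring : CommutativeRing 0ℓ 0ℓ
  ℤₚ-ring = record
    { Carrier = ℤₚ
    ; _≈_ = _≈_
    ; _+_ = _+_
    ; _*_ = _*_
    ; -_  = -_
    ; 0#  = fromℤ 0ℤ
    ; 1#  = fromℤ 1ℤ
    ; isCommutativeRing = record
      { isRing = record
        { +-isAbelianGroup = record
          { isGroup = record
            { isMonoid = record
              { isSemigroup = record
                { isMagma = record
                  { isEquivalence = record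
                    { refl  = pointwise λ _ → refl
                    ; sym   = λ h → mk≈ λ n → symₚ (residue-≡ h n)
                    ; trans = λ h k → mk≈ λ n →
                        transₚ (residue-≡ h n) (residue-≡ k n)
                    }
                  ; ∙-cong = λ h k → mk≈ λ n →
                      +-congₚ (residue-≡ h n) (residue-≡ k n)
                  }
                ; assoc = λ a b c → pointwise λ n →
                    ℤ.+-assoc (residue a n) (residue b n) (residue c n)
                }
              ; identity =
                  (λ a → pointwise λ n → ℤ.+-identityˡ (residue a n))
                , (λ a → pointwise λ n → ℤ.+-identityʳ (residue a n))
              }
            ; inverse =
                (λ a → pointwise λ n → ℤ.+-inverseˡ (residue a n))
              , (λ a → pointwise λ n → ℤ.+-inverseʳ (residue a n))
            ; ⁻¹-cong = λ h → mk≈ λ n → neg-congₚ (residue-≡ h n)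
            }
          ; comm = λ a b → pointwise λ n →
              ℤ.+-comm (residue a n) (residue b n)
          }
        ; *-cong = λ h k → mk≈ λ n →
            *-congₚ (residue-≡ h n) (residue-≡ k n)
        ; *-assoc = λ a b c → pointwise λ n →
            ℤ.*-assoc (residue a n) (residue b n) (residue c n)
        ; *-identity =
            (λ a → pointwise λ n → ℤ.*-identityˡ (residue a n))
          , (λ a → pointwise λ n → ℤ.*-identityʳ (residue a n))
        ; distrib =
            (λ a b c → pointwise λ n →
              ℤ.*-distribˡ-+ (residue a n) (residue b n) (residue c n))
          , (λ a b c → pointwise λ n →
              ℤ.*-distribʳ-+ (residue a n) (residue b n) (residue c n))
        }
      ; *-comm = λ a b → pointwise λ n →
          ℤ.*-comm (residue a n) (residue b n)
      }
    }

------------------------------------------------------------------------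
-- R[√d] = R[X] / (X² - d), with x +√ y standing for x + y √d.

module Quadratic {c ℓ} (R : CommutativeRing c ℓ)
                 (d : CommutativeRing.Carrier R) where

  private
    module R = CommutativeRing R
  open SemiringSolver R.commutativeSemiring using (solve; _:+_; _:*_; _:=_; con)

  infix  4 _≈_
  infix  5 _+√_
  infixl 6 _+_
  infixl 7 _*_
  infix  8 -_

  record R[√d] : Set c where
    constructor _+√_
    field
      rat irr : R.Carrier

  open R[√d] public

  record _≈_ (z w : R[√d]) : Set ℓ where
    constructor mk≈
    field
      rat-≈ : rat z R.≈ rat w
      irr-≈ : irr z R.≈ irr w

  open _≈_ public

  _+_ : R[√d] → R[√d] → R[√d]
  (x +√ y) + (x′ +√ y′) = (x R.+ x′) +√ (y R.+ y′)

  _*_ : R[√d] → R[√d] → R[√d]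
  (x +√ y) * (x′ +√ y′) =
    (x R.* x′ R.+ y R.* y′ R.* d) +√ (x R.* y′ R.+ y R.* x′)

  -_ : R[√d] → R[√d]
  - (x +√ y) = (R.- x) +√ (R.- y)

  embed : R.Carrier → R[√d]
  embed x = x +√ R.0#

  norm : R[√d] → R.Carrier
  norm (x +√ y) = x R.* x R.- y R.* y R.* d

  ring : CommutativeRing c ℓ
  ring = record
    { Carrier = R[√d]
    ; _≈_ = _≈_
    ; _+_ = _+_
    ; _*_ = _*_
    ; -_  = -_
    ; 0#  = embed R.0#
    ; 1#  = embed R.1#
    ; isCommutativeRing = record
      { isRing = record
        { +-isAbelianGroup = record
          { isGroup = record
            { isMonoid = record
              { isSemigroup = record
                { isMagma = record
                  { isEquivalence = record
                    { refl  = mk≈ R.refl R.refl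
                    ; sym   = λ (mk≈ h k) → mk≈ (R.sym h) (R.sym k)
                    ; trans = λ (mk≈ h k) (mk≈ h′ k′) →
                        mk≈ (R.trans h h′) (R.trans k k′)
                    }
                  ; ∙-cong = λ (mk≈ h k) (mk≈ h′ k′) →
                      mk≈ (R.+-cong h h′) (R.+-cong k k′)
                  }
                ; assoc = λ (x +√ y) (x′ +√ y′) (x″ +√ y″) →
                    mk≈ (R.+-assoc x x′ x″) (R.+-assoc y y′ y″)
                }
              ; identity =
                  (λ (x +√ y) → mk≈ (R.+-identityˡ x) (R.+-identityˡ y))
                , (λ (x +√ y) → mk≈ (R.+-identityʳ x) (R.+-identityʳ y))
              }
            ; inverse =
                (λ (x +√ y) → mk≈ (R.-‿inverseˡ x) (R.-‿inverseˡ y))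
              , (λ (x +√ y) → mk≈ (R.-‿inverseʳ x) (R.-‿inverseʳ y))
            ; ⁻¹-cong = λ (mk≈ h k) → mk≈ (R.-‿cong h) (R.-‿cong k)
            }
          ; comm = λ (x +√ y) (x′ +√ y′) →
              mk≈ (R.+-comm x x′) (R.+-comm y y′)
          }
        ; *-cong = λ (mk≈ h k) (mk≈ h′ k′) →
            mk≈ (R.+-cong (R.*-cong h h′)
                          (R.*-cong (R.*-cong k k′) R.refl))
                (R.+-cong (R.*-cong h k′) (R.*-cong k h′))
        ; *-assoc = λ (x +√ y) (x′ +√ y′) (x″ +√ y″) → mk≈
            (solve 7 (λ x y x′ y′ x″ y″ d →
                (x :* x′ :+ y :* y′ :* d) :* x″ :+ (x :* y′ :+ y :* x′) :* y″ :* d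
                := x :* (x′ :* x″ :+ y′ :* y″ :* d) :+ y :* (x′ :* y″ :+ y′ :* x″) :* d)
              R.refl x y x′ y′ x″ y″ d)
            (solve 7 (λ x y x′ y′ x″ y″ d →
                (x :* x′ :+ y :* y′ :* d) :* y″ :+ (x :* y′ :+ y :* x′) :* x″
                := x :* (x′ :* y″ :+ y′ :* x″) :+ y :* (x′ :* x″ :+ y′ :* y″ :* d))
              R.refl x y x′ y′ x″ y″ d)
        ; *-identity = identityˡ , λ z →
            ≈-trans (*-comm z (embed R.1#)) (identityˡ z)
        ; distrib = distribˡ , λ z w v →
            ≈-trans (*-comm (w + v) z)
              (≈-trans (distribˡ z w v) (+-cong (*-comm z w) (*-comm z v)))
        }
      ; *-comm = *-comm
      }
    }
    where
    ≈-trans : ∀ {z w v} → z ≈ w → w ≈ v → z ≈ v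
    ≈-trans (mk≈ h k) (mk≈ h′ k′) = mk≈ (R.trans h h′) (R.trans k k′)

    +-cong : ∀ {z w z′ w′} → z ≈ z′ → w ≈ w′ → z + w ≈ z′ + w′
    +-cong (mk≈ h k) (mk≈ h′ k′) = mk≈ (R.+-cong h h′) (R.+-cong k k′)

    *-comm : ∀ z w → z * w ≈ w * z
    *-comm (x +√ y) (x′ +√ y′) = mk≈
      (solve 5 (λ x y x′ y′ d →
          x :* x′ :+ y :* y′ :* d := x′ :* x :+ y′ :* y :* d)
        R.refl x y x′ y′ d)
      (solve 4 (λ x y x′ y′ → x :* y′ :+ y :* x′ := x′ :* y :+ y′ :* x)
        R.refl x y x′ y′)

    identityˡ : ∀ z → embed R.1# * z ≈ z
    identityˡ (x +√ y) = mk≈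
      (solve 3 (λ x y d → con 1 :* x :+ con 0 :* y :* d := x)
        R.refl x y d)
      (solve 2 (λ x y → con 1 :* y :+ con 0 :* x := y)
        R.refl x y)

    distribˡ : ∀ z w v → z * (w + v) ≈ z * w + z * v
    distribˡ (x +√ y) (x′ +√ y′) (x″ +√ y″) = mk≈
      (solve 7 (λ x y x′ y′ x″ y″ d →
          x :* (x′ :+ x″) :+ y :* (y′ :+ y″) :* d
          := (x :* x′ :+ y :* y′ :* d) :+ (x :* x″ :+ y :* y″ :* d))
        R.refl x y x′ y′ x″ y″ d)
      (solve 6 (λ x y x′ y′ x″ y″ →
          x :* (y′ :+ y″) :+ y :* (x′ :+ x″)
          := (x :* y′ :+ y :* x′) :+ (x :* y″ :+ y :* x″))
        R.refl x y x′ y′ x″ y″)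

------------------------------------------------------------------------

ℤₚ : ℕ → Set
ℤₚ p = PAdic.ℤₚ p

module _ (p : ℕ) where

  open CommutativeRing (PAdic.ℤₚ-ring p)
    using (_≈_; 1#) renaming (_*_ to _·_)

  IsUnit : Pred (ℤₚ p) 0ℓ
  IsUnit = AlgebraicDefinitions.Invertible _≈_ 1# _·_

  IsSquare : Pred (ℤₚ p) 0ℓ
  IsSquare a = ∃[ x ] x · x ≈ a

module ℤₚ[√d] {p : ℕ} (d : ℤₚ p) where

  private
    module Zp = CommutativeRing (PAdic.ℤₚ-ring p)
  open Quadratic (PAdic.ℤₚ-ring p) d public
    using (_+√_; embed; norm) renaming (R[√d] to 𝒪; ring to 𝒪-ring)
  open CommutativeRing 𝒪-ring public
    using (_≈_; _+_; _*_; _-_; 0#; 1#)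
  open SemiringExp (CommutativeRing.semiring 𝒪-ring) public
    using (_^_)

  pᵒ : 𝒪
  pᵒ = embed (PAdic.fromℤ p (+ p))

  -- The ideal pᵏ 𝒪 for k ∈ ℕ ∪ {∞}, where p^∞ 𝒪 = {0}.
  p^_·𝒪 : ℕ ⁺ → Pred 𝒪 0ℓ
  p^ [ k ] ·𝒪 z = ∃[ w ] z ≈ pᵒ ^ k * w
  p^ ⊤⁺ ·𝒪 z = z ≈ 0#

  coset : 𝒪 → ℕ ⁺ → Pred 𝒪 0ℓ
  coset a k z = z - a ∈ p^ k ·𝒪

  -- νₚ(z) = k. When d ∈ ℤₚ is a unit and a non-square and p is odd, p is a
  -- uniformizer of 𝒪, so νₚ is exact divisibility by powers of p in 𝒪.
  -- It is a relation because νₚ is not computable (z = 0 is undecidable).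
  ν_is_ : 𝒪 → ℕ ⁺ → Set
  ν z is [ k ] = z ∈ p^ [ k ] ·𝒪 × ¬ (z ∈ p^ [ suc k ] ·𝒪)
  ν z is ⊤⁺ = z ≈ 0#

  U⁰ : Pred 𝒪 0ℓ
  U⁰ z = AlgebraicDefinitions.Invertible _≈_ 1# _*_ z
       × (norm z Zp.≈ Zp.1# ⊎ norm z Zp.≈ Zp.- Zp.1#)

  record HasOrderModP (a : 𝒪) (l : ℕ) : Set where
    field
      positive : 1 ≤ l
      period   : a ^ l - 1# ∈ p^ [ 1 ] ·𝒪
      least    : ∀ m → 1 ≤ m → a ^ m - 1# ∈ p^ [ 1 ] ·𝒪 → l ≤ m

  -- Closure for the p-adic topology: the sets z + pᵐ 𝒪 are a neighbourhood
  -- basis at z.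
  closure : Pred 𝒪 ℓ → Pred 𝒪 ℓ
  closure S z = ∀ (m : ℕ) → ∃[ s ] s ∈ S × s ∈ coset z [ m ]

  powers : 𝒪 → Pred 𝒪 0ℓ
  powers a z = Σ[ n ∈ ℕ ] z ≈ a ^ n

  record IsClosedSubgroupOfU⁰ (S : Pred 𝒪 ℓ) : Set ℓ where
    field
      ⊆U⁰       : S ⊆ U⁰
      1∈        : 1# ∈ S
      *-closed  : ∀ {z w} → z ∈ S → w ∈ S → z * w ∈ S
      ⁻¹-closed : ∀ {z w} → z ∈ S → z * w ≈ 1# → w ∈ S
      closed    : closure S ∩ U⁰ ⊆ S

  record IsClosedSubgroupGeneratedBy (ℓ : Level) (a : 𝒪) (S : Pred 𝒪 0ℓ) :
         Set (lsuc ℓ) where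
    field
      isClosedSubgroup : IsClosedSubgroupOfU⁰ S
      generator        : a ∈ S
      least            : (T : Pred 𝒪 ℓ) → IsClosedSubgroupOfU⁰ T → a ∈ T → S ⊆ T

{-# OPTIONS --safe #-}

-- A norm-one element 1 + pᵉ (x + y √d) with e ≥ 1 has p ∣ x, because expanding the norm gives
-- 2x = - pᵉ (x² - d y²); so modulo pᵉ⁺¹ it is determined by y mod p.  Put u = aˡ, which is 1 modulo
-- pᵏ but not modulo pᵏ⁺¹.  Then u^(pᵐ) is 1 modulo exactly pᵏ⁺ᵐ, and its powers exhaust the norm-one
-- elements of 1 + pᵏ⁺ᵐ 𝒪 modulo pᵏ⁺ᵐ⁺¹.  By successive approximation the powers of u are dense in
-- the norm-one elements of 1 + pᵏ 𝒪, and translating by powers of a gives the cosets.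
--
-- For the last claim, projection from (-1, 0) shows that the conic x² - d y² = 1 has at most p + 1
-- points modulo p.  If a has order 2 (p + 1) then N(a) = -1, the p + 1 even powers of a are all the
-- norm-one classes modulo p, and the odd powers are all those of norm -1.

module Submission where

open import Defs
open import Algebra.Bundles using (CommutativeRing)
import Algebra.Properties.CommutativeSemiring.Exp as Exp
import Algebra.Properties.Ring as RingProperties
import Algebra.Solver.Ring as RingSolver
open import Algebra.Solver.Ring.AlmostCommutativeRing using (_-Raw-AlmostCommutative⟶_; fromCommutativeRing)
import Algebra.Solver.Ring.NaturalCoefficients.Default as SemiringSolver
open import Data.Fin.Base as Fin using (Fin; toℕ; fromℕ; fromℕ<; zero; suc)
import Data.Fin.Properties as Fin
open import Data.Integer.Base as ℤ using (ℤ; +_; 0ℤ; 1ℤ)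
open import Data.Integer.Divisibility.Signed
import Data.Integer.DivMod as ℤ
import Data.Integer.Properties as ℤ
open import Data.Integer.Tactic.RingSolver using (solve-∀)
open import Data.Maybe.Base using (Maybe; just; nothing)
open import Data.Nat.Base as ℕ using (ℕ; zero; suc; _≤_; s≤s; z≤n)
open import Data.Nat.Coprimality using (Coprime; coprime-Bézout)
open import Data.Nat.DivMod using (_%_; _/_; _mod_; m≡m%n+[m/n]*n; m%n<n)
import Data.Nat.Divisibility as ℕ
open import Data.Nat.GCD using (module Bézout)
open import Data.Nat.Primality using (Prime; euclidsLemma; prime⇒irreducible; prime⇒nonZero)
import Data.Nat.Properties as ℕ
import Data.Nat.Tactic.RingSolver as ℕ-Solver
open import Data.Product.Base using (∃-syntax; _×_; _,_; proj₁; proj₂)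
open import Data.Sum.Base as Sum using (_⊎_; inj₁; inj₂; [_,_]′)
open import Function.Base using (id)
open import Level using (_⊔_)
open import Relation.Binary.Definitions using (tri<; tri≈; tri>)
open import Relation.Binary.PropositionalEquality as ≡ using (_≡_; _≢_; cong; subst; subst₂)
open import Relation.Nullary using (¬_; yes; no; contradiction)
open import Relation.Nullary.Construct.Add.Supremum using (_⁺; [_]; ⊤⁺)
open import Relation.Unary using (Pred; _∈_; _⊆_; _≐_; _⊥_; _∩_; ⋃)

-- Indexed so that triangular n is the binomial coefficient n (n - 1) / 2.
triangular : ℕ → ℕ
triangular zero    = 0
triangular (suc n) = triangular n ℕ.+ n

-- Used with `suc (h + h)` equal to `p`: the coefficient of the quadratic term in a `p`-th power is
-- then a multiple of `p`.
triangular-odd : ∀ h → triangular (suc (h ℕ.+ h)) ≡ suc (h ℕ.+ h) ℕ.* h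
triangular-odd zero    = ≡.refl
triangular-odd (suc h) = ≡.trans
  (cong (λ n → triangular (suc n) ℕ.+ suc n) (ℕ.+-suc h h))
  (≡.trans (cong (λ t → t ℕ.+ suc (h ℕ.+ h) ℕ.+ suc (suc (h ℕ.+ h))) (triangular-odd h)) (eq h))
  where
  eq : ∀ h → suc (h ℕ.+ h) ℕ.* h ℕ.+ suc (h ℕ.+ h) ℕ.+ suc (suc (h ℕ.+ h))
           ≡ suc (suc h ℕ.+ suc h) ℕ.* suc h
  eq = ℕ-Solver.solve-∀

∣-resp : ∀ {m x y} → x ≡ y → m ∣ x → m ∣ y
∣-resp ≡.refl m∣x = m∣x

-- Congruences modulo powers of an element of a commutative ring.

module _ {c ℓ} (R : CommutativeRing c ℓ) where

  open CommutativeRing R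

  -- The parameters make `⟦_⟧` a ring homomorphism, so the solver can work with integer
  -- coefficients. Stating this part for any commutative ring keeps the coordinates of `𝒪` out of
  -- the computations.
  module Adic (⟦_⟧ : ℤ → Carrier)
              (+-homo : ∀ m n → ⟦ m ℤ.+ n ⟧ ≈ ⟦ m ⟧ + ⟦ n ⟧)
              (*-homo : ∀ m n → ⟦ m ℤ.* n ⟧ ≈ ⟦ m ⟧ * ⟦ n ⟧)
              (-‿homo : ∀ n → ⟦ ℤ.- n ⟧ ≈ - ⟦ n ⟧)
              (0-homo : ⟦ + 0 ⟧ ≈ 0#)
              (1-homo : ⟦ + 1 ⟧ ≈ 1#)
              (p : ℕ) where

    open Exp commutativeSemiring
    open import Relation.Binary.Reasoning.Setoid setoid

    private
      -- Two solvers are needed: `S` knows the literals `0#` and `1#` but has no subtraction, while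
      -- the one built on `φ` subtracts but has to treat `1#` as a variable.
      module S = SemiringSolver commutativeSemiring

      _≟⟦⟧_ : ∀ a b → Maybe (⟦ a ⟧ ≈ ⟦ b ⟧)
      a ≟⟦⟧ b with a ℤ.≟ b
      ... | yes a≡b = just (reflexive (≡.cong ⟦_⟧ a≡b))
      ... | no  _   = nothing

      φ : ℤ.+-*-rawRing -Raw-AlmostCommutative⟶ fromCommutativeRing R
      φ = record
        { ⟦_⟧ = ⟦_⟧ ; +-homo = +-homo ; *-homo = *-homo ; -‿homo = -‿homo ; 0-homo = 0-homo ; 1-homo = 1-homo }

    open RingSolver ℤ.+-*-rawRing (fromCommutativeRing R) φ _≟⟦⟧_
      using (solve; _:+_; _:*_; _:-_; :-_; _:=_)

    π : Carrier
    π = ⟦ + p ⟧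

    infix 4 _≡_[π^_]

    record _≡_[π^_] (x y : Carrier) (n : ℕ) : Set (c ⊔ ℓ) where
      constructor mk≡
      field
        cofactor : Carrier
        x-y≈π^n* : x - y ≈ π ^ n * cofactor

    ≈⇒≡ : ∀ {x y} n → x ≈ y → x ≡ y [π^ n ]
    ≈⇒≡ {x} {y} n x≈y = mk≡ 0# (begin
      x - y       ≈⟨ +-congʳ x≈y ⟩
      y - y       ≈⟨ -‿inverseʳ y ⟩
      0#          ≈⟨ zeroʳ (π ^ n) ⟨
      π ^ n * 0#  ∎)

    ≡-sym : ∀ {x y} n → x ≡ y [π^ n ] → y ≡ x [π^ n ]
    ≡-sym {x} {y} n (mk≡ w eq) = mk≡ (- w) (begin
      y - x          ≈⟨ solve 2 (λ x y → y :- x := :- (x :- y)) refl x y ⟩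
      - (x - y)      ≈⟨ -‿cong eq ⟩
      - (π ^ n * w)  ≈⟨ solve 2 (λ q w → :- (q :* w) := q :* (:- w)) refl (π ^ n) w ⟩
      π ^ n * - w    ∎)

    ≡-trans : ∀ {x y z} n → x ≡ y [π^ n ] → y ≡ z [π^ n ] → x ≡ z [π^ n ]
    ≡-trans {x} {y} {z} n (mk≡ w eq) (mk≡ w′ eq′) = mk≡ (w + w′) (begin
      x - z                   ≈⟨ solve 3 (λ x y z → x :- z := (x :- y) :+ (y :- z)) refl x y z ⟩
      (x - y) + (y - z)       ≈⟨ +-cong eq eq′ ⟩
      π ^ n * w + π ^ n * w′  ≈⟨ distribˡ (π ^ n) w w′ ⟨
      π ^ n * (w + w′)        ∎)

    *-cong-≡ : ∀ {x y x′ y′} n → x ≡ y [π^ n ] → x′ ≡ y′ [π^ n ] → x * x′ ≡ y * y′ [π^ n ]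
    *-cong-≡ {x} {y} {x′} {y′} n (mk≡ w eq) (mk≡ w′ eq′) = mk≡ (w * x′ + y * w′) (begin
      x * x′ - y * y′
        ≈⟨ solve 4 (λ x y x′ y′ → x :* x′ :- y :* y′ := (x :- y) :* x′ :+ y :* (x′ :- y′)) refl x y x′ y′ ⟩
      (x - y) * x′ + y * (x′ - y′)
        ≈⟨ +-cong (*-congʳ eq) (*-congˡ eq′) ⟩
      π ^ n * w * x′ + y * (π ^ n * w′)
        ≈⟨ solve 5 (λ q w x′ y w′ → q :* w :* x′ :+ y :* (q :* w′) := q :* (w :* x′ :+ y :* w′))
                 refl (π ^ n) w x′ y w′ ⟩
      π ^ n * (w * x′ + y * w′)
        ∎)

    *-congˡ-≡ : ∀ {x y} z n → x ≡ y [π^ n ] → z * x ≡ z * y [π^ n ]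
    *-congˡ-≡ z n = *-cong-≡ n (≈⇒≡ n refl)

    *-congʳ-≡ : ∀ {x y} z n → x ≡ y [π^ n ] → x * z ≡ y * z [π^ n ]
    *-congʳ-≡ z n x≡y = *-cong-≡ n x≡y (≈⇒≡ n refl)

    ^-cong-≡ : ∀ {x y} n m → x ≡ y [π^ n ] → x ^ m ≡ y ^ m [π^ n ]
    ^-cong-≡ n zero    x≡y = ≈⇒≡ n refl
    ^-cong-≡ n (suc m) x≡y = *-cong-≡ n x≡y (^-cong-≡ n m x≡y)

    1^ : ∀ n → 1# ^ n ≈ 1#
    1^ zero    = refl
    1^ (suc n) = trans (*-identityˡ _) (1^ n)

    ≡1⇒^≡1 : ∀ {x} n m → x ≡ 1# [π^ n ] → x ^ m ≡ 1# [π^ n ]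
    ≡1⇒^≡1 n m x≡1 = ≡-trans n (^-cong-≡ n m x≡1) (≈⇒≡ n (1^ m))

    ≡-weaken : ∀ {x y m n} → m ≤ n → x ≡ y [π^ n ] → x ≡ y [π^ m ]
    ≡-weaken {x} {y} {m} {n} m≤n (mk≡ w eq) = mk≡ (π ^ (n ℕ.∸ m) * w) (begin
      x - y                        ≈⟨ eq ⟩
      π ^ n * w                    ≡⟨ ≡.cong (λ n → π ^ n * w) (≡.sym (ℕ.m+[n∸m]≡n m≤n)) ⟩
      π ^ (m ℕ.+ (n ℕ.∸ m)) * w    ≈⟨ *-congʳ (^-homo-* π m (n ℕ.∸ m)) ⟩
      π ^ m * π ^ (n ℕ.∸ m) * w    ≈⟨ *-assoc _ _ _ ⟩
      π ^ m * (π ^ (n ℕ.∸ m) * w)  ∎)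

    ≡-cancelʳ : ∀ {x y u v} n → u * v ≈ 1# → x * u ≡ y * u [π^ n ] → x ≡ y [π^ n ]
    ≡-cancelʳ {x} {y} {u} {v} n uv≈1 xu≡yu =
      ≡-trans n (≈⇒≡ n (sym (expand x))) (≡-trans n (*-congʳ-≡ v n xu≡yu) (≈⇒≡ n (expand y)))
      where
      expand : ∀ x → x * u * v ≈ x
      expand x = trans (*-assoc x u v) (trans (*-congˡ uv≈1) (*-identityʳ x))

    inverse-^ : ∀ {u v} n → u * v ≈ 1# → u ^ n * v ^ n ≈ 1#
    inverse-^ {u} {v} n uv≈1 = trans (sym (^-distrib-* u v n)) (trans (^-congˡ n uv≈1) (1^ n))

    -- Elements close to one and the binomial expansion.

    x-1≈y⇒x≈1+y : ∀ {x y} → x - 1# ≈ y → x ≈ 1# + y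
    x-1≈y⇒x≈1+y {x} eq = trans (solve 2 (λ x i → x := i :+ (x :- i)) refl x 1#) (+-congˡ eq)

    x≈1+y⇒x-1≈y : ∀ {x y} → x ≈ 1# + y → x - 1# ≈ y
    x≈1+y⇒x-1≈y {x} {y} eq = trans (+-congʳ eq) (solve 2 (λ i y → i :+ y :- i := y) refl 1# y)

    -- Only the coefficients up to degree two have to be known exactly; `g` collects everything of
    -- degree three and more.
    [1+x]^n : ∀ x n → ∃[ g ] (1# + x) ^ n ≈
              1# + ⟦ + n ⟧ * x + ⟦ + triangular n ⟧ * (x * x) + x * x * x * g
    [1+x]^n x zero = 0# , (begin
      1#
        ≈⟨ S.solve 1 (λ x → S.con 1 S.:= S.con 1 S.:+ S.con 0 S.:* x S.:+ S.con 0 S.:* (x S.:* x)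
                                         S.:+ x S.:* x S.:* x S.:* S.con 0) refl x ⟩
      1# + 0# * x + 0# * (x * x) + x * x * x * 0#
        ≈⟨ +-congʳ (+-cong (+-congˡ (*-congʳ 0-homo)) (*-congʳ 0-homo)) ⟨
      1# + ⟦ + 0 ⟧ * x + ⟦ + 0 ⟧ * (x * x) + x * x * x * 0#
        ∎)
    [1+x]^n x (suc n) with g , eq ← [1+x]^n x n = T + g + x * g , (begin
      (1# + x) * (1# + x) ^ n
        ≈⟨ *-congˡ eq ⟩
      (1# + x) * (1# + A * x + T * (x * x) + x * x * x * g)
        ≈⟨ S.solve 4 (λ x A T g →
             (S.con 1 S.:+ x) S.:* (S.con 1 S.:+ A S.:* x S.:+ T S.:* (x S.:* x) S.:+ x S.:* x S.:* x S.:* g)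
             S.:= S.con 1 S.:+ (S.con 1 S.:+ A) S.:* x S.:+ (T S.:+ A) S.:* (x S.:* x)
                  S.:+ x S.:* x S.:* x S.:* (T S.:+ g S.:+ x S.:* g)) refl x A T g ⟩
      1# + (1# + A) * x + (T + A) * (x * x) + x * x * x * (T + g + x * g)
        ≈⟨ +-congʳ (+-cong (+-congˡ (*-congʳ (trans (+-homo (+ 1) (+ n)) (+-congʳ 1-homo))))
                           (*-congʳ (+-homo (+ triangular n) (+ n)))) ⟨
      1# + ⟦ + suc n ⟧ * x + ⟦ + triangular (suc n) ⟧ * (x * x) + x * x * x * (T + g + x * g)
        ∎)
      where
      A = ⟦ + n ⟧
      T = ⟦ + triangular n ⟧

    -- The quadratic term is harmless because p divides p (p - 1) / 2.
    [1+π^e*w]^p : ∀ h → p ≡ suc (h ℕ.+ h) → ∀ e w →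
                  ∃[ s ] (1# + π ^ suc e * w) ^ p ≈ 1# + π ^ suc (suc e) * (w * (1# + π * s))
    [1+π^e*w]^p h p≡1+2h e w with g , eq ← [1+x]^n (π ^ suc e * w) p = s , (begin
      (1# + X) ^ p
        ≈⟨ eq ⟩
      1# + π * X + ⟦ + triangular p ⟧ * (X * X) + X * X * X * g
        ≈⟨ +-congʳ (+-congˡ (*-congʳ triangular-p)) ⟩
      1# + π * X + π * H * (X * X) + X * X * X * g
        ≈⟨ S.solve 5 (λ π q w H g → let X = (π S.:* q) S.:* w in
              S.con 1 S.:+ π S.:* X S.:+ π S.:* H S.:* (X S.:* X) S.:+ X S.:* X S.:* X S.:* g
              S.:= S.con 1 S.:+ (π S.:* (π S.:* q)) S.:*
                     (w S.:* (S.con 1 S.:+ π S.:* (H S.:* q S.:* w S.:+ q S.:* q S.:* w S.:* w S.:* g))))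
             refl π q w H g ⟩
      1# + π ^ suc (suc e) * (w * (1# + π * s))
        ∎)
      where
      X = π ^ suc e * w
      q = π ^ e
      H = ⟦ + h ⟧
      -- What is left of the quadratic and cubic terms once `π ^ suc (suc e) * w * π` is taken out.
      s = H * q * w + q * q * w * w * g

      triangular-p : ⟦ + triangular p ⟧ ≈ π * H
      triangular-p = begin
        ⟦ + triangular p ⟧
          ≡⟨ ≡.cong (λ n → ⟦ + triangular n ⟧) p≡1+2h ⟩
        ⟦ + triangular (suc (h ℕ.+ h)) ⟧
          ≡⟨ ≡.cong (λ n → ⟦ + n ⟧) (triangular-odd h) ⟩
        ⟦ + (suc (h ℕ.+ h) ℕ.* h) ⟧
          ≡⟨ ≡.cong (λ n → ⟦ + (n ℕ.* h) ⟧) p≡1+2h ⟨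
        ⟦ + (p ℕ.* h) ⟧
          ≡⟨ ≡.cong ⟦_⟧ (ℤ.pos-* p h) ⟩
        ⟦ + p ℤ.* + h ⟧
          ≈⟨ *-homo (+ p) (+ h) ⟩
        π * H
          ∎

    -- The terms of degree two and more are divisible by the square of `π ^ suc e`, hence by
    -- `π ^ suc (suc e)` because the exponent `suc e` is at least one.
    [1+π^e*w]^t : ∀ e w t → (1# + π ^ suc e * w) ^ t ≡ 1# + ⟦ + t ⟧ * (π ^ suc e * w) [π^ suc (suc e) ]
    [1+π^e*w]^t e w t with g , eq ← [1+x]^n (π ^ suc e * w) t = mk≡ (q * w * w * (T + X * g)) (begin
      (1# + X) ^ t - (1# + ⟦ + t ⟧ * X)
        ≈⟨ +-congʳ eq ⟩
      1# + ⟦ + t ⟧ * X + T * (X * X) + X * X * X * g - (1# + ⟦ + t ⟧ * X)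
        ≈⟨ solve 4 (λ a T X g → a :+ T :* (X :* X) :+ X :* X :* X :* g :- a
                                := X :* X :* (T :+ X :* g))
              refl (1# + ⟦ + t ⟧ * X) T X g ⟩
      X * X * (T + X * g)
        ≈⟨ solve 4 (λ π q w u → π :* q :* w :* (π :* q :* w) :* u := π :* (π :* q) :* (q :* w :* w :* u))
              refl π q w (T + X * g) ⟩
      π ^ suc (suc e) * (q * w * w * (T + X * g))
        ∎)
      where
      X = π ^ suc e * w
      q = π ^ e
      T = ⟦ + triangular t ⟧

    ≡-lift-^p : ∀ h → p ≡ suc (h ℕ.+ h) → ∀ {x} e → x ≡ 1# [π^ suc e ] → x ^ p ≡ 1# [π^ suc (suc e) ]
    ≡-lift-^p h p≡1+2h {x} e (mk≡ w eq) =
      let s , eq′ = [1+π^e*w]^p h p≡1+2h e w in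
      mk≡ (w * (1# + π * s)) (x≈1+y⇒x-1≈y (trans (^-congˡ p (x-1≈y⇒x≈1+y eq)) eq′))

    -- Each `p`-th power gains one factor `π`. This supplies exponents that send `a` as close to
    -- `1#` as desired.
    ≡-lift-^p^m : ∀ h → p ≡ suc (h ℕ.+ h) → ∀ {x} m → x ≡ 1# [π^ 1 ] → x ^ (p ℕ.^ m) ≡ 1# [π^ suc m ]
    ≡-lift-^p^m h p≡1+2h zero    x≡1 = ≡-trans 1 (≈⇒≡ 1 (*-identityʳ _)) x≡1
    ≡-lift-^p^m h p≡1+2h {x} (suc m) x≡1 = ≡-trans (suc (suc m))
      (≈⇒≡ (suc (suc m)) (trans (^-congʳ x (ℕ.*-comm p (p ℕ.^ m))) (sym (^-assocʳ x (p ℕ.^ m) p))))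
      (≡-lift-^p h p≡1+2h m (≡-lift-^p^m h p≡1+2h m x≡1))

    π^n*π^1*w : ∀ n w → π ^ n * (π ^ 1 * w) ≈ π ^ suc n * w
    π^n*π^1*w n w = S.solve 3 (λ π q w → q S.:* (π S.:* S.con 1 S.:* w) S.:= π S.:* q S.:* w) refl π (π ^ n) w

    ≡1+-refine : ∀ {v w w′ c s} n → v - 1# ≈ π ^ n * w′ → w′ - c * w ≈ π ^ 1 * s →
                 v ≡ 1# + c * (π ^ n * w) [π^ suc n ]
    ≡1+-refine {v} {w} {w′} {c} {s} n eq eq′ = mk≡ s (begin
      v - (1# + c * (π ^ n * w))
        ≈⟨ solve 3 (λ v i x → v :- (i :+ x) := (v :- i) :- x) refl v 1# (c * (π ^ n * w)) ⟩
      (v - 1#) - c * (π ^ n * w)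
        ≈⟨ +-congʳ eq ⟩
      π ^ n * w′ - c * (π ^ n * w)
        ≈⟨ solve 4 (λ q w′ c w → q :* w′ :- c :* (q :* w) := q :* (w′ :- c :* w)) refl (π ^ n) w′ c w ⟩
      π ^ n * (w′ - c * w)
        ≈⟨ *-congˡ eq′ ⟩
      π ^ n * (π ^ 1 * s)
        ≈⟨ π^n*π^1*w n s ⟩
      π ^ suc n * s
        ∎)

    -- To this precision, raising to the power `t` multiplies the leading coefficient by `t`.
    -- Matching `v` by a power of `u` is therefore a linear congruence modulo `π`.
    ≡-^-refine : ∀ {u v w w′} e t → u - 1# ≈ π ^ suc e * w → v - 1# ≈ π ^ suc e * w′ →
                 w′ ≡ ⟦ + t ⟧ * w [π^ 1 ] → v ≡ u ^ t [π^ suc (suc e) ]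
    ≡-^-refine {u} {v} {w} {w′} e t eq eq′ (mk≡ s eq″) =
      ≡-trans E (≡1+-refine {w = w} {c = ⟦ + t ⟧} (suc e) eq′ eq″)
        (≡-sym E (≡-trans E (≈⇒≡ E (^-congˡ t (x-1≈y⇒x≈1+y eq))) ([1+π^e*w]^t e w t)))
      where E = suc (suc e)

    -- Elements `u` for which `u - 1#` has valuation exactly `n`.

    Exact : Carrier → ℕ → Set _
    Exact u n = u ≡ 1# [π^ n ] × ¬ (u ≡ 1# [π^ suc n ])

    Exact⇒π∤ : ∀ {u w w₁ n} → Exact u n → u - 1# ≈ π ^ n * w → ¬ w ≈ π ^ 1 * w₁
    Exact⇒π∤ {n = n} (_ , u≢1) eq w≈ = u≢1 (mk≡ _ (trans eq (trans (*-congˡ w≈) (π^n*π^1*w n _))))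

    Exact-resp : ∀ {u v} n → u ≈ v → Exact u n → Exact v n
    Exact-resp n u≈v (u≡1 , u≢1) =
      ≡-trans n (≈⇒≡ n (sym u≈v)) u≡1 , λ v≡1 → u≢1 (≡-trans (suc n) (≈⇒≡ (suc n) u≈v) v≡1)

    π^-TorsionFree : Set _
    π^-TorsionFree = ∀ n {z} → π ^ n * z ≈ 0# → z ≈ 0#

    -- The leading coefficient `w` turns into `w * (1# + π * s)`, which is congruent to `w` modulo
    -- `π`; so the level rises by one and by no more.
    Exact-^p : π^-TorsionFree → ∀ h → p ≡ suc (h ℕ.+ h) →
               ∀ {u} e → Exact u (suc e) → Exact (u ^ p) (suc (suc e))
    Exact-^p torsionFree h p≡1+2h {u} e (mk≡ w eq , u≢1) =
      let s , eq′ = [1+π^e*w]^p h p≡1+2h e w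
          u^p-1≈ = x≈1+y⇒x-1≈y (trans (^-congˡ p (x-1≈y⇒x≈1+y eq)) eq′)
      in mk≡ (w * (1# + π * s)) u^p-1≈ , λ (mk≡ w₂ eq₂) →
         u≢1 (mk≡ (w₂ - w * s) (trans eq (trans (*-congˡ (divisible w w₂ s (trans (sym u^p-1≈) eq₂)))
                                                (π^n*π^1*w (suc e) (w₂ - w * s)))))
      where
      -- Cancelling `π ^ suc (suc e)` leaves `w + π w s = π w₂`, which explains the cofactor
      -- `w₂ - w * s`. Torsion-freeness is what permits the cancellation.
      divisible : ∀ w w₂ s → π ^ suc (suc e) * (w * (1# + π * s)) ≈ π ^ suc (suc (suc e)) * w₂ →
                  w ≈ π ^ 1 * (w₂ - w * s)
      divisible w w₂ s eq = begin
        w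
          ≈⟨ solve 2 (λ w y → w := (w :- y) :+ y) refl w y ⟩
        (w - y) + y
          ≈⟨ +-congʳ (torsionFree (suc (suc e)) vanishes) ⟩
        0# + y
          ≈⟨ +-identityˡ y ⟩
        y
          ∎
        where
        y = π ^ 1 * (w₂ - w * s)
        Q = π ^ suc (suc e)
        vanishes : Q * (w - y) ≈ 0#
        vanishes = begin
          Q * (w - y)
            ≈⟨ solve 6 (λ Q w π i w₂ s → Q :* (w :- π :* i :* (w₂ :- w :* s))
                         := Q :* (w :+ w :* (π :* i :* s)) :- Q :* (π :* i) :* w₂)
                 refl Q w π 1# w₂ s ⟩
          Q * (w + w * (π * 1# * s)) - Q * (π * 1#) * w₂
            ≈⟨ +-cong
                 (S.solve 4 (λ Q w π s → Q S.:* (w S.:+ w S.:* (π S.:* S.con 1 S.:* s))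
                                         S.:= Q S.:* (w S.:* (S.con 1 S.:+ π S.:* s))) refl Q w π s)
                 (-‿cong (S.solve 3 (λ Q π w → Q S.:* (π S.:* S.con 1) S.:* w S.:= π S.:* Q S.:* w)
                                    refl Q π w₂)) ⟩
          Q * (w * (1# + π * s)) - π * Q * w₂
            ≈⟨ +-congʳ eq ⟩
          π * Q * w₂ - π * Q * w₂
            ≈⟨ -‿inverseʳ (π * Q * w₂) ⟩
          0#
            ∎

    Exact-^p^m : π^-TorsionFree → ∀ h → p ≡ suc (h ℕ.+ h) →
                 ∀ {u} e m → Exact u (suc e) → Exact (u ^ (p ℕ.^ m)) (suc (m ℕ.+ e))
    Exact-^p^m torsionFree h p≡1+2h {u} e zero exact = Exact-resp (suc e) (sym (*-identityʳ u)) exact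
    Exact-^p^m torsionFree h p≡1+2h {u} e (suc m) exact = Exact-resp (suc (suc (m ℕ.+ e)))
      (trans (^-assocʳ u (p ℕ.^ m) p) (^-congʳ u (ℕ.*-comm (p ℕ.^ m) p)))
      (Exact-^p torsionFree h p≡1+2h (m ℕ.+ e) (Exact-^p^m torsionFree h p≡1+2h e m exact))

    -- Density of powers by successive approximation.

    module _ {q} (P : Pred Carrier q) (P-1 : P 1#) (P-* : ∀ {x y} → P x → P y → P (x * y))
             (approximate : ∀ {u v} e → P u → P v → Exact u (suc e) → v ≡ 1# [π^ suc e ] →
                            ∃[ t ] v ≡ u ^ t [π^ suc (suc e) ])
             (torsionFree : π^-TorsionFree) (h : ℕ) (p≡1+2h : p ≡ suc (h ℕ.+ h)) where

      P-^ : ∀ {x} n → P x → P (x ^ n)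
      P-^ zero    Px = P-1
      P-^ (suc n) Px = P-* Px (P-^ n Px)

      -- Induction on the number of digits. The error `v * u⁻¹ ^ n` is `1#` to the precision
      -- reached, and `u ^ (p ^ m)` is exact at that same level, so `approximate` matches the next
      -- digit by its `t`-th power. `P` stands for the norm-one condition, which the error must
      -- satisfy for `approximate` to apply.
      Exact⇒dense : ∀ {u u⁻¹ v} e → u * u⁻¹ ≈ 1# → P u → P u⁻¹ → Exact u (suc e) →
                    P v → v ≡ 1# [π^ suc e ] → ∀ m → ∃[ n ] v ≡ u ^ n [π^ suc (m ℕ.+ e) ]
      Exact⇒dense e uu⁻¹≈1 Pu Pu⁻¹ exact Pv v≡1 zero = 0 , v≡1
      Exact⇒dense {u} {u⁻¹} {v} e uu⁻¹≈1 Pu Pu⁻¹ exact Pv v≡1 (suc m) =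
        let n , v≡u^n = Exact⇒dense e uu⁻¹≈1 Pu Pu⁻¹ exact Pv v≡1 m
            u^n*u⁻¹^n≈1 = inverse-^ n uu⁻¹≈1
            t , v′≡ = approximate (m ℕ.+ e) (P-^ (p ℕ.^ m) Pu) (P-* Pv (P-^ n Pu⁻¹))
                        (Exact-^p^m torsionFree h p≡1+2h e m exact)
                        (≡-trans E (*-congʳ-≡ (u⁻¹ ^ n) E v≡u^n) (≈⇒≡ E u^n*u⁻¹^n≈1))
        in p ℕ.^ m ℕ.* t ℕ.+ n ,
           ≡-trans (suc E) (≈⇒≡ (suc E) (restore n u^n*u⁻¹^n≈1))
             (≡-trans (suc E) (*-congʳ-≡ (u ^ n) (suc E) v′≡)
               (≈⇒≡ (suc E) (trans (*-congʳ (^-assocʳ u (p ℕ.^ m) t)) (sym (^-homo-* u (p ℕ.^ m ℕ.* t) n)))))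
        where
        E = suc (m ℕ.+ e)
        restore : ∀ n → u ^ n * u⁻¹ ^ n ≈ 1# → v ≈ v * u⁻¹ ^ n * u ^ n
        restore n eq = sym (trans (*-assoc v (u⁻¹ ^ n) (u ^ n))
          (trans (*-congˡ (trans (*-comm (u⁻¹ ^ n) (u ^ n)) eq)) (*-identityʳ v)))

      -- Apply density to v = z a⁻ⁿ and the unit u = aˡ.
      Exact⇒dense-coset : ∀ {a a⁻¹ z} l n e → a * a⁻¹ ≈ 1# → P (a ^ l) → P (a⁻¹ ^ l) → Exact (a ^ l) (suc e) →
                          P (z * a⁻¹ ^ n) → z ≡ a ^ n [π^ suc e ] → ∀ m → ∃[ j ] a ^ j ≡ z [π^ m ]
      Exact⇒dense-coset {a} {a⁻¹} {z} l n e aa⁻¹≈1 Pu Pu⁻¹ exact Pv z≡a^n m =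
        let j , v≡ = Exact⇒dense e (inverse-^ l aa⁻¹≈1) Pu Pu⁻¹ exact Pv
                       (≡-trans (suc e) (*-congʳ-≡ (a⁻¹ ^ n) (suc e) z≡a^n) (≈⇒≡ (suc e) (inverse-^ n aa⁻¹≈1))) m
        in l ℕ.* j ℕ.+ n , ≡-weaken (ℕ.m≤n⇒m≤1+n (ℕ.m≤m+n m e))
             (≡-sym E (≡-cancelʳ E (trans (*-comm _ _) (inverse-^ n aa⁻¹≈1))
               (≡-trans E v≡ (≈⇒≡ E (expand j)))))
        where
        E = suc (m ℕ.+ e)
        expand : ∀ j → (a ^ l) ^ j ≈ a ^ (l ℕ.* j ℕ.+ n) * a⁻¹ ^ n
        expand j = begin
          (a ^ l) ^ j                          ≈⟨ ^-assocʳ a l j ⟩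
          a ^ (l ℕ.* j)                        ≈⟨ *-identityʳ _ ⟨
          a ^ (l ℕ.* j) * 1#                   ≈⟨ *-congˡ (inverse-^ n aa⁻¹≈1) ⟨
          a ^ (l ℕ.* j) * (a ^ n * a⁻¹ ^ n)    ≈⟨ *-assoc _ _ _ ⟨
          a ^ (l ℕ.* j) * a ^ n * a⁻¹ ^ n      ≈⟨ *-congʳ (^-homo-* a (l ℕ.* j) n) ⟨
          a ^ (l ℕ.* j ℕ.+ n) * a⁻¹ ^ n        ∎

    -- Elements of finite order modulo `π`.

    module Order {a a⁻¹ l} (aa⁻¹≈1 : a * a⁻¹ ≈ 1#) (1≤l : 1 ≤ l) (period : a ^ l ≡ 1# [π^ 1 ])
                 (least : ∀ m → 1 ≤ m → a ^ m ≡ 1# [π^ 1 ] → l ≤ m) where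

      instance
        l≢0 : ℕ.NonZero l
        l≢0 = ℕ.>-nonZero 1≤l

      -- Cancelling the invertible `a ^ i` turns a coincidence of two powers into a period.
      order≤gap : ∀ {i j} → i ℕ.< j → a ^ i ≡ a ^ j [π^ 1 ] → l ≤ j ℕ.∸ i
      order≤gap {i} {j} i<j a^i≡a^j = least (j ℕ.∸ i) (ℕ.m<n⇒0<n∸m i<j)
        (≡-cancelʳ 1 (inverse-^ i aa⁻¹≈1)
          (≡-trans 1 (≈⇒≡ 1 split) (≡-trans 1 (≡-sym 1 a^i≡a^j) (≈⇒≡ 1 (sym (*-identityˡ (a ^ i)))))))
        where
        split : a ^ (j ℕ.∸ i) * a ^ i ≈ a ^ j
        split = trans (sym (^-homo-* a (j ℕ.∸ i) i)) (^-congʳ a (ℕ.m∸n+n≡m (ℕ.<⇒≤ i<j)))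

      ^-injective : ∀ {i j} → i ℕ.< l → j ℕ.< l → a ^ i ≡ a ^ j [π^ 1 ] → i ≡ j
      ^-injective {i} {j} i<l j<l a^i≡a^j with ℕ.<-cmp i j
      ... | tri≈ _ i≡j _ = i≡j
      ... | tri< i<j _ _ = contradiction (ℕ.≤-trans (order≤gap i<j a^i≡a^j) (ℕ.m∸n≤m j i)) (ℕ.<⇒≱ j<l)
      ... | tri> _ _ j<i = contradiction (ℕ.≤-trans (order≤gap j<i (≡-sym 1 a^i≡a^j)) (ℕ.m∸n≤m i j)) (ℕ.<⇒≱ i<l)

      -- The precision `m` is left free: it is taken to be 1, a finite `k`, or arbitrary when
      -- `a ^ l` equals `1#`.
      ^-% : ∀ m n → a ^ l ≡ 1# [π^ m ] → a ^ n ≡ a ^ (n % l) [π^ m ]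
      ^-% m n a^l≡1 = ≡-trans m (≈⇒≡ m split)
        (≡-trans m (*-congˡ-≡ (a ^ (n % l)) m (≡1⇒^≡1 m (n / l) a^l≡1)) (≈⇒≡ m (*-identityʳ _)))
        where
        split : a ^ n ≈ a ^ (n % l) * (a ^ l) ^ (n / l)
        split = begin
          a ^ n                              ≡⟨ ≡.cong (a ^_) (m≡m%n+[m/n]*n n l) ⟩
          a ^ (n % l ℕ.+ n / l ℕ.* l)        ≈⟨ ^-homo-* a (n % l) (n / l ℕ.* l) ⟩
          a ^ (n % l) * a ^ (n / l ℕ.* l)    ≡⟨ ≡.cong (λ k → a ^ (n % l) * a ^ k) (ℕ.*-comm (n / l) l) ⟩
          a ^ (n % l) * a ^ (l ℕ.* (n / l))  ≈⟨ *-congˡ (^-assocʳ a l (n / l)) ⟨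
          a ^ (n % l) * (a ^ l) ^ (n / l)    ∎

      -- With `L = l * p ^ m` the power `a ^ L` is close to `1#`, so `a ^ (n * L - n)` approximately
      -- inverts `a ^ n`. Natural exponents thus suffice for a closure that contains inverses.
      ^-inverse : ∀ h → p ≡ suc (h ℕ.+ h) → ∀ m n → ∃[ j ] a ^ j * a ^ n ≡ 1# [π^ m ]
      ^-inverse h p≡1+2h m n = n ℕ.* L ℕ.∸ n ,
        ≡-trans m (≈⇒≡ m combine) (≡1⇒^≡1 m n (≡-weaken (ℕ.n≤1+n m) a^L≡1))
        where
        L = l ℕ.* p ℕ.^ m
        instance
          p≢0 : ℕ.NonZero p
          p≢0 = ≡.subst ℕ.NonZero (≡.sym p≡1+2h) _
          L≢0 : ℕ.NonZero L
          L≢0 = ℕ.m*n≢0 l (p ℕ.^ m) {{l≢0}} {{ℕ.m^n≢0 p m}}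
        a^L≡1 : a ^ L ≡ 1# [π^ suc m ]
        a^L≡1 = ≡-trans (suc m) (≈⇒≡ (suc m) (sym (^-assocʳ a l (p ℕ.^ m)))) (≡-lift-^p^m h p≡1+2h m period)
        combine : a ^ (n ℕ.* L ℕ.∸ n) * a ^ n ≈ (a ^ L) ^ n
        combine = begin
          -- The truncated subtraction is a true one because `L` is nonzero.
          a ^ (n ℕ.* L ℕ.∸ n) * a ^ n  ≈⟨ ^-homo-* a (n ℕ.* L ℕ.∸ n) n ⟨
          a ^ (n ℕ.* L ℕ.∸ n ℕ.+ n)    ≡⟨ ≡.cong (a ^_) (ℕ.m∸n+n≡m (ℕ.m≤m*n n L)) ⟩
          a ^ (n ℕ.* L)                ≡⟨ ≡.cong (a ^_) (ℕ.*-comm n L) ⟩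
          a ^ (L ℕ.* n)                ≈⟨ ^-assocʳ a L n ⟨
          (a ^ L) ^ n                  ∎

      -- Modulo `π` the inverse of `a` is its power with exponent `l - 1`.
      ^-divide : ∀ {z} n → z * a ≡ a ^ n [π^ 1 ] → z ≡ a ^ (n ℕ.+ ℕ.pred l) [π^ 1 ]
      ^-divide {z} n za≡a^n = ≡-cancelʳ 1 aa⁻¹≈1 (≡-trans 1 za≡a^n (≡-sym 1
        (≡-trans 1 (≈⇒≡ 1 combine) (≡-trans 1 (*-congˡ-≡ (a ^ n) 1 period) (≈⇒≡ 1 (*-identityʳ (a ^ n)))))))
        where
        combine : a ^ (n ℕ.+ ℕ.pred l) * a ≈ a ^ n * a ^ l
        combine = begin
          a ^ (n ℕ.+ ℕ.pred l) * a        ≈⟨ *-congʳ (^-homo-* a n (ℕ.pred l)) ⟩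
          a ^ n * a ^ ℕ.pred l * a        ≈⟨ *-assoc _ _ _ ⟩
          a ^ n * (a ^ ℕ.pred l * a)      ≈⟨ *-congˡ (*-comm _ _) ⟩
          a ^ n * a ^ suc (ℕ.pred l)      ≡⟨ ≡.cong (λ k → a ^ n * a ^ k) (ℕ.suc-pred l) ⟩
          a ^ n * a ^ l                   ∎

-- Arithmetic modulo an odd prime.

module ModPrime (p : ℕ) (pp : Prime p) (3≤p : 3 ≤ p) where

  open import Data.Integer.Base using (_+_; _*_; _-_; -_)

  private instance
    _ = prime⇒nonZero pp

  euclid : ∀ x y → + p ∣ x * y → + p ∣ x ⊎ + p ∣ y
  euclid x y p∣xy = Sum.map ∣ᵤ⇒∣ ∣ᵤ⇒∣
    (euclidsLemma ℤ.∣ x ∣ ℤ.∣ y ∣ pp (subst (p ℕ.∣_) (ℤ.abs-* x y) (∣⇒∣ᵤ p∣xy)))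

  euclidʳ : ∀ x {y} → ¬ + p ∣ x → + p ∣ x * y → + p ∣ y
  euclidʳ x p∤x p∣xy = [ (λ p∣x → contradiction p∣x p∤x) , id ]′ (euclid x _ p∣xy)

  p∤2 : ¬ + p ∣ + 2
  p∤2 p∣2 = ℕ.<⇒≱ 3≤p (ℕ.∣⇒≤ (∣⇒∣ᵤ p∣2))

  p∤1 : ¬ + p ∣ 1ℤ
  p∤1 p∣1 = p∤2 (∣n⇒∣m*n (+ 2) p∣1)

  p-odd : ∃[ h ] p ≡ suc (h ℕ.+ h)
  p-odd with parity p
    where
    parity : ∀ n → ∃[ h ] (n ≡ h ℕ.+ h ⊎ n ≡ suc (h ℕ.+ h))
    parity zero = 0 , inj₁ ≡.refl
    parity (suc n) with parity n
    ... | h , inj₁ eq = h , inj₂ (cong suc eq)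
    ... | h , inj₂ eq = suc h , inj₁ (cong suc (≡.trans eq (≡.sym (ℕ.+-suc h h))))
  ... | h , inj₂ eq = h , eq
  ... | h , inj₁ eq = contradiction (prime⇒irreducible pp (ℕ.divides h (≡.trans eq (h+h≡h*2 h))))
                        [ (λ ()) , (λ 2≡p → ℕ.<⇒≢ 3≤p 2≡p) ]′
    where
    h+h≡h*2 : ∀ h → h ℕ.+ h ≡ h ℕ.* 2
    h+h≡h*2 = ℕ-Solver.solve-∀

  -- Bézout inverts the absolute value of `x`; for negative `x` the sign moves to the inverse.
  ∤⇒inverse : ∀ x → ¬ + p ∣ x → ∃[ u ] + p ∣ u * x - 1ℤ
  ∤⇒inverse x p∤x = [ (λ +n≡x → v , ∣-resp (cong (λ y → v * y - 1ℤ) +n≡x) p∣vn-1)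
                    , (λ +n≡-x → - v , ∣-resp (≡.trans (cong (λ y → v * y - 1ℤ) +n≡-x) (neg v x)) p∣vn-1)
                    ]′ (ℤ.+∣i∣≡i⊎+∣i∣≡-i x)
    where
    n = ℤ.∣ x ∣

    coprime : Coprime p n
    coprime (d∣p , d∣n) with prime⇒irreducible pp d∣p
    ... | inj₁ d≡1  = d≡1
    ... | inj₂ ≡.refl = contradiction (∣ᵤ⇒∣ d∣n) p∤x

    neg : ∀ v x → v * (- x) - 1ℤ ≡ (- v) * x - 1ℤ
    neg = solve-∀
    eq₁ : ∀ b n → (- b) * n - 1ℤ ≡ - (1ℤ + b * n)
    eq₁ = solve-∀
    eq₂ : ∀ c → (1ℤ + c) - 1ℤ ≡ c
    eq₂ = solve-∀

    cast : ∀ a b c d → 1 ℕ.+ a ℕ.* b ≡ c ℕ.* d → 1ℤ + + a * + b ≡ + c * + d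
    cast a b c d eq = ≡.trans (cong (λ y → 1ℤ + y) (≡.sym (ℤ.pos-* a b))) (≡.trans (cong +_ eq) (ℤ.pos-* c d))

    inverse-n : ∃[ v ] + p ∣ v * + n - 1ℤ
    inverse-n with coprime-Bézout coprime
    ... | Bézout.+- a b eq = - (+ b) ,
      ∣-resp (≡.sym (eq₁ (+ b) (+ n))) (∣m⇒∣-m (divides (+ a) (cast b n a p eq)))
    ... | Bézout.-+ a b eq = + b ,
      divides (+ a) (≡.trans (cong (_- 1ℤ) (≡.sym (cast a p b n eq))) (eq₂ (+ a * + p)))

    v = proj₁ inverse-n
    p∣vn-1 = proj₂ inverse-n

  %-spec : ∀ x → ∃[ t ] t ℕ.< p × + p ∣ x - + t
  %-spec x = x ℤ.%ℕ p , ℤ.n%ℕd<d x p ,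
    divides (x ℤ./ℕ p) (≡.trans (cong (_- + (x ℤ.%ℕ p)) (ℤ.a≡a%ℕn+[a/ℕn]*n x p)) (eq (+ (x ℤ.%ℕ p)) _))
    where
    eq : ∀ a b → a + b - a ≡ b
    eq = solve-∀

  -- The quotient is reduced to a natural number below `p`, since it serves as an exponent and as a
  -- slope.
  ∤⇒quotient : ∀ x y → ¬ + p ∣ x → ∃[ t ] t ℕ.< p × + p ∣ y - + t * x
  ∤⇒quotient x y p∤x =
    let u , p∣ux-1 = ∤⇒inverse x p∤x
        t , t<p , p∣yu-t = %-spec (y * u)
    in t , t<p , ∣-resp (eq x y u (+ t)) (∣m∣n⇒∣m-n (∣m⇒∣m*n x p∣yu-t) (∣n⇒∣m*n y p∣ux-1))
    where
    eq : ∀ x y u t → (y * u - t) * x - y * (u * x - 1ℤ) ≡ y - t * x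
    eq = solve-∀

  -- Points of a conic modulo `p`.

  -- The slope of the line joining (-1, 0) to (x, y), the value p standing for ∞.
  IsSlope : Fin (suc p) → ℤ → ℤ → Set
  IsSlope t x y = (toℕ t ≡ p × + p ∣ x + 1ℤ)
                ⊎ (toℕ t ℕ.< p × ¬ + p ∣ x + 1ℤ × + p ∣ y - + toℕ t * (x + 1ℤ))

  slope : ∀ x y → ∃[ t ] IsSlope t x y
  slope x y with + p ∣? x + 1ℤ
  ... | yes p∣x+1 = fromℕ p , inj₁ (Fin.toℕ-fromℕ p , p∣x+1)
  ... | no  p∤x+1 =
    let t , t<p , p∣y-t[x+1] = ∤⇒quotient (x + 1ℤ) y p∤x+1
        t<1+p = ℕ.m<n⇒m<1+n t<p
        t≡ = ≡.sym (Fin.toℕ-fromℕ< t<1+p)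
    in fromℕ< t<1+p , inj₂
         (subst (ℕ._< p) t≡ t<p , p∤x+1 , subst (λ t → + p ∣ y - + t * (x + 1ℤ)) t≡ p∣y-t[x+1])

  OnConic : ℤ → ℤ → ℤ → Set
  OnConic δ x y = + p ∣ x * x - y * y * δ - 1ℤ

  -- A line through (-1, 0) meets the conic x² - δ y² = 1 in at most one other point.
  slope-injective : ∀ {δ} → ¬ + p ∣ δ → ∀ {x y x′ y′ t} → OnConic δ x y → OnConic δ x′ y′ →
                    IsSlope t x y → IsSlope t x′ y′ → + p ∣ x - x′ × + p ∣ y - y′
  slope-injective {δ} p∤δ {x} {y} {x′} {y′} c c′ (inj₁ (_ , h)) (inj₁ (_ , h′)) =
    ∣-resp (eq x x′) (∣m∣n⇒∣m-n h h′) , ∣m∣n⇒∣m-n (p∣y x y c h) (p∣y x′ y′ c′ h′)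
    where
    eq : ∀ x x′ → (x + 1ℤ) - (x′ + 1ℤ) ≡ x - x′
    eq = solve-∀
    eq′ : ∀ x y δ → (x - 1ℤ) * (x + 1ℤ) - (x * x - y * y * δ - 1ℤ) ≡ δ * (y * y)
    eq′ = solve-∀
    -- At `x = -1` the equation of the conic leaves `δ y² = 0`, so only one point has slope ∞.
    p∣y : ∀ x y → OnConic δ x y → + p ∣ x + 1ℤ → + p ∣ y
    p∣y x y c h = [ id , id ]′ (euclid y y (euclidʳ δ p∤δ
      (∣-resp (eq′ x y δ) (∣m∣n⇒∣m-n (∣n⇒∣m*n (x - 1ℤ) h) c))))
  slope-injective {δ} p∤δ {x} {y} {x′} {y′} {t} c c′ (inj₂ (_ , h , k)) (inj₂ (_ , h′ , k′)) =
    p∣x-x′ , ∣-resp (eq₄ x y x′ y′ τ)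
                    (∣m∣n⇒∣m+n (∣m∣n⇒∣m-n k k′) (∣n⇒∣m*n τ p∣x-x′))
    where
    τ = + toℕ t
    eq₁ : ∀ x y δ t → (x * x - y * y * δ - 1ℤ) + (y - t * (x + 1ℤ)) * ((y + t * (x + 1ℤ)) * δ)
                    ≡ (x + 1ℤ) * ((x - 1ℤ) - δ * t * t * (x + 1ℤ))
    eq₁ = solve-∀
    eq₂ : ∀ x δ t → (x + 1ℤ) * (1ℤ - δ * t * t) - ((x - 1ℤ) - δ * t * t * (x + 1ℤ)) ≡ + 2
    eq₂ = solve-∀
    eq₃ : ∀ x x′ δ t → ((x - 1ℤ) - δ * t * t * (x + 1ℤ)) - ((x′ - 1ℤ) - δ * t * t * (x′ + 1ℤ))
                     ≡ (1ℤ - δ * t * t) * (x - x′)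
    eq₃ = solve-∀
    eq₄ : ∀ x y x′ y′ t → ((y - t * (x + 1ℤ)) - (y′ - t * (x′ + 1ℤ))) + t * (x - x′) ≡ y - y′
    eq₄ = solve-∀
    -- Substituting `y = τ (x + 1)` into the conic and dividing by `x + 1` leaves an equation linear
    -- in `x`.
    rational : ∀ x y → OnConic δ x y → ¬ + p ∣ x + 1ℤ → + p ∣ y - τ * (x + 1ℤ) →
               + p ∣ (x - 1ℤ) - δ * τ * τ * (x + 1ℤ)
    rational x y c h k = euclidʳ (x + 1ℤ) h
      (∣-resp (eq₁ x y δ τ) (∣m∣n⇒∣m+n c (∣m⇒∣m*n ((y + τ * (x + 1ℤ)) * δ) k)))
    r  = rational x y c h k
    r′ = rational x′ y′ c′ h′ k′
    -- If `δ τ²` were 1, this linear equation would read `-2 = 0`.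
    p∤1-δτ² : ¬ + p ∣ 1ℤ - δ * τ * τ
    p∤1-δτ² q = p∤2 (∣-resp (eq₂ x δ τ) (∣m∣n⇒∣m-n (∣n⇒∣m*n (x + 1ℤ) q) r))
    p∣x-x′ : + p ∣ x - x′
    p∣x-x′ = euclidʳ (1ℤ - δ * τ * τ) p∤1-δτ² (∣-resp (eq₃ x x′ δ τ) (∣m∣n⇒∣m-n r r′))
  slope-injective p∤δ c c′ (inj₁ (t≡p , _)) (inj₂ (t<p , _)) = contradiction t≡p (ℕ.<⇒≢ t<p)
  slope-injective p∤δ c c′ (inj₂ (t<p , _)) (inj₁ (t≡p , _)) = contradiction t≡p (ℕ.<⇒≢ t<p)

-- Divisibility of `p`-adic integers, read off residues.

module Padic (p : ℕ) (pp : Prime p) (3≤p : 3 ≤ p) where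

  open PAdic p hiding (ℤₚ)
  open ModPrime p pp 3≤p
  module Zp = CommutativeRing ℤₚ-ring

  p^n≢0 : ∀ n → ℤ.NonZero (+ (p ℕ.^ n))
  p^n≢0 n = ℕ.m^n≢0 p n {{prime⇒nonZero pp}}

  pointwise : ∀ {x y} → (∀ n → residue x n ≡ residue y n) → x ≈ y
  pointwise {x} {y} eq = mk≈ λ n → mk≡ (divides 0ℤ (ℤ.i≡j⇒i-j≡0 (eq n)))

  p∣p^1+n : ∀ n → + p ∣ + (p ℕ.^ suc n)
  p∣p^1+n n = ∣ᵤ⇒∣ (ℕ.m∣m*n (p ℕ.^ n))

  p^1∣⇒p∣ : ∀ {x} → + (p ℕ.^ 1) ∣ x → + p ∣ x
  p^1∣⇒p∣ = subst (λ q → + q ∣ _) (ℕ.*-identityʳ p)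

  p∣⇒p^1∣ : ∀ {x} → + p ∣ x → + (p ℕ.^ 1) ∣ x
  p∣⇒p^1∣ = subst (λ q → + q ∣ _) (≡.sym (ℕ.*-identityʳ p))

  p^n∣p^[j+n] : ∀ j n → + (p ℕ.^ n) ∣ + (p ℕ.^ (j ℕ.+ n))
  p^n∣p^[j+n] j n = ∣ᵤ⇒∣ (subst (p ℕ.^ n ℕ.∣_) (≡.sym (ℕ.^-distribˡ-+-* p j n)) (ℕ.n∣m*n (p ℕ.^ j)))

  stable : ∀ x n j → + (p ℕ.^ n) ∣ residue x (j ℕ.+ n) ℤ.- residue x n
  stable x n zero    = divides 0ℤ (ℤ.+-inverseʳ (residue x n))
  stable x n (suc j) = ∣-resp (eq (residue x (suc j ℕ.+ n)) (residue x (j ℕ.+ n)) (residue x n))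
    (∣m∣n⇒∣m+n (∣-trans (p^n∣p^[j+n] j n) (p^n∣x-y (coherent x (j ℕ.+ n)))) (stable x n j))
    where
    eq : ∀ a b c → (a ℤ.- b) ℤ.+ (b ℤ.- c) ≡ a ℤ.- c
    eq = solve-∀

  ∣-lower : ∀ x n j → + (p ℕ.^ n) ∣ residue x (j ℕ.+ n) → + (p ℕ.^ n) ∣ residue x n
  ∣-lower x n j h = ∣-resp (eq (residue x (j ℕ.+ n)) (residue x n)) (∣m∣n⇒∣m-n h (stable x n j))
    where
    eq : ∀ a b → a ℤ.- (a ℤ.- b) ≡ b
    eq = solve-∀

  ∣-raise : ∀ x n j → + (p ℕ.^ n) ∣ residue x n → + (p ℕ.^ n) ∣ residue x (j ℕ.+ n)
  ∣-raise x n j h = ∣-resp (eq (residue x (j ℕ.+ n)) (residue x n)) (∣m∣n⇒∣m+n h (stable x n j))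
    where
    eq : ∀ a b → b ℤ.+ (a ℤ.- b) ≡ a
    eq = solve-∀

  p^[_] : ℕ → ℤₚ p
  p^[ n ] = fromℤ (+ (p ℕ.^ n))

  +p^-+ : ∀ m n → + (p ℕ.^ (m ℕ.+ n)) ≡ + (p ℕ.^ m) ℤ.* + (p ℕ.^ n)
  +p^-+ m n = ≡.trans (cong +_ (ℕ.^-distribˡ-+-* p m n)) (ℤ.pos-* (p ℕ.^ m) (p ℕ.^ n))

  -- Division by `p ^ n` costs `n` digits of precision, so the `j`-th residue of the quotient comes
  -- from the residue of `x` at `j + n`.
  ∣residue⇒factor : ∀ n x → + (p ℕ.^ n) ∣ residue x n → ∃[ w ] x ≈ p^[ n ] * w
  ∣residue⇒factor n x h = w , mk≈ λ j → mk≡ (∣-resp (eq₂ j) (∣m⇒∣-m (shifted j)))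
    where
    Q = + (p ℕ.^ n)
    x≡q*Q : ∀ j → residue x (j ℕ.+ n) ≡ quotient (∣-raise x n j h) ℤ.* Q
    x≡q*Q j = _∣_.equality (∣-raise x n j h)
    eq₁ : ∀ a b c → a ℤ.* c ℤ.- b ℤ.* c ≡ (a ℤ.- b) ℤ.* c
    eq₁ = solve-∀
    w : ℤₚ p
    w = mkℤₚ (λ j → quotient (∣-raise x n j h)) λ j → mk≡ (*-cancelʳ-∣ Q {{p^n≢0 n}}
      (subst₂ _∣_ (+p^-+ j n)
        (≡.trans (≡.cong₂ ℤ._-_ (x≡q*Q (suc j)) (x≡q*Q j))
                 (eq₁ (quotient (∣-raise x n (suc j) h)) (quotient (∣-raise x n j h)) Q))
        (p^n∣x-y (coherent x (j ℕ.+ n)))))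
    eq₂ : ∀ j → ℤ.- (residue x (j ℕ.+ n) ℤ.- residue x j) ≡ residue x j ℤ.- Q ℤ.* residue w j
    eq₂ j = ≡.trans (cong (λ y → ℤ.- (y ℤ.- residue x j)) (x≡q*Q j))
                    (eq₃ (residue w j) Q (residue x j))
      where
      eq₃ : ∀ a b c → ℤ.- (a ℤ.* b ℤ.- c) ≡ c ℤ.- b ℤ.* a
      eq₃ = solve-∀
    shifted : ∀ j → + (p ℕ.^ j) ∣ residue x (j ℕ.+ n) ℤ.- residue x j
    shifted j = subst (λ i → + (p ℕ.^ j) ∣ residue x i ℤ.- residue x j) (ℕ.+-comm n j) (stable x j n)

  ∣residue-resp : ∀ n {x y} → x ≈ y → + (p ℕ.^ n) ∣ residue y n → + (p ℕ.^ n) ∣ residue x n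
  ∣residue-resp n {x} {y} x≈y h =
    ∣-resp (eq (residue x n) (residue y n)) (∣m∣n⇒∣m+n (p^n∣x-y (residue-≡ x≈y n)) h)
    where
    eq : ∀ a b → (a ℤ.- b) ℤ.+ b ≡ a
    eq = solve-∀

  factor⇒∣residue : ∀ n {x} w → x ≈ p^[ n ] * w → + (p ℕ.^ n) ∣ residue x n
  factor⇒∣residue n w x≈ = ∣residue-resp n x≈ (∣m⇒∣m*n (residue w n) ∣-refl)

  -- The digits lost in cancelling `p ^ n` are made up for by reading the hypothesis at `j + n` and
  -- then lowering the index to `j`.
  p^n-torsionFree : ∀ n x → p^[ n ] * x ≈ fromℤ 0ℤ → x ≈ fromℤ 0ℤ
  p^n-torsionFree n x h = mk≈ λ j → mk≡ (∣-resp (eq₁ (residue x j))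
    (∣-lower′ j (*-cancelˡ-∣ Q {{p^n≢0 n}} (subst₂ _∣_ (≡.trans (+p^-+ j n) (ℤ.*-comm (+ (p ℕ.^ j)) Q))
       (eq₁′ (Q ℤ.* residue x (j ℕ.+ n))) (p^n∣x-y (residue-≡ h (j ℕ.+ n)))))))
    where
    Q = + (p ℕ.^ n)
    eq₁ : ∀ a → a ≡ a ℤ.- 0ℤ
    eq₁ = solve-∀
    eq₁′ : ∀ a → a ℤ.- 0ℤ ≡ a
    eq₁′ = solve-∀
    ∣-lower′ : ∀ j → + (p ℕ.^ j) ∣ residue x (j ℕ.+ n) → + (p ℕ.^ j) ∣ residue x j
    ∣-lower′ j h = ∣-lower x j n (subst (λ i → + (p ℕ.^ j) ∣ residue x i) (ℕ.+-comm j n) h)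

  -- The sign may a priori depend on `n`. As `p` is odd, 1 and -1 differ modulo `p`, so the sign
  -- found at `n = 1` is forced at every later `n`.
  ±1-limit : ∀ x → (∀ n → + (p ℕ.^ n) ∣ residue x n ℤ.- 1ℤ ⊎ + (p ℕ.^ n) ∣ residue x n ℤ.- (ℤ.- 1ℤ)) →
             x ≈ fromℤ 1ℤ ⊎ x ≈ - fromℤ 1ℤ
  ±1-limit x h = [ (λ k → inj₁ (mk≈ λ n → mk≡ (plus k n))) , (λ k → inj₂ (mk≈ λ n → mk≡ (minus k n))) ]′ (h 1)
    where
    eq : ∀ a b → ((a ℤ.- b) ℤ.+ (b ℤ.- 1ℤ)) ℤ.- (a ℤ.- (ℤ.- 1ℤ)) ≡ ℤ.- + 2
    eq = solve-∀
    eq′ : ∀ a b → (a ℤ.- 1ℤ) ℤ.- ((a ℤ.- b) ℤ.+ (b ℤ.- (ℤ.- 1ℤ))) ≡ ℤ.- + 2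
    eq′ = solve-∀
    p∤-2 : ¬ + p ∣ ℤ.- + 2
    p∤-2 q = p∤2 (∣m⇒∣-m q)
    shift : ∀ n → + p ∣ residue x (suc n) ℤ.- residue x 1
    shift n = p^1∣⇒p∣ (subst (λ i → + (p ℕ.^ 1) ∣ residue x i ℤ.- residue x 1) (ℕ.+-comm n 1) (stable x 1 n))
    p∣ : ∀ n {y} → + (p ℕ.^ suc n) ∣ y → + p ∣ y
    p∣ n = ∣-trans (p∣p^1+n n)
    plus : + (p ℕ.^ 1) ∣ residue x 1 ℤ.- 1ℤ → ∀ n → + (p ℕ.^ n) ∣ residue x n ℤ.- 1ℤ
    plus k zero = ∣ᵤ⇒∣ (ℕ.1∣ _)
    plus k (suc n) = [ id , (λ q → contradiction (∣-resp (eq (residue x (suc n)) (residue x 1))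
      (∣m∣n⇒∣m-n (∣m∣n⇒∣m+n (shift n) (p^1∣⇒p∣ k)) (p∣ n q))) p∤-2) ]′ (h (suc n))
    minus : + (p ℕ.^ 1) ∣ residue x 1 ℤ.- (ℤ.- 1ℤ) → ∀ n → + (p ℕ.^ n) ∣ residue x n ℤ.- (ℤ.- 1ℤ)
    minus k zero = ∣ᵤ⇒∣ (ℕ.1∣ _)
    minus k (suc n) = [ (λ q → contradiction (∣-resp (eq′ (residue x (suc n)) (residue x 1))
      (∣m∣n⇒∣m-n (p∣ n q) (∣m∣n⇒∣m+n (shift n) (p^1∣⇒p∣ k)))) p∤-2) , id ]′ (h (suc n))

-- The quadratic ring `𝒪` and its coordinates.

module QuadraticExtension (p : ℕ) (pp : Prime p) (3≤p : 3 ≤ p) (d : ℤₚ p) where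

  open ModPrime p pp 3≤p
  open Padic p pp 3≤p
  open PAdic p using (residue; residue-≡; p^n∣x-y; fromℤ; ℤₚ-ring)
  open ℤₚ[√d] d
  module Q = Quadratic ℤₚ-ring d
  open Q using (rat; irr; mk≈; rat-≈; irr-≈)
  module 𝓞 = CommutativeRing 𝒪-ring
  open Exp 𝓞.commutativeSemiring public using (^-homo-*; ^-assocʳ; ^-congˡ; ^-congʳ)

  pointwise² : ∀ {z w} → (∀ n → residue (rat z) n ≡ residue (rat w) n) →
               (∀ n → residue (irr z) n ≡ residue (irr w) n) → z ≈ w
  pointwise² h k = mk≈ (pointwise h) (pointwise k)

  ⟦_⟧ : ℤ → 𝒪
  ⟦ n ⟧ = embed (fromℤ n)

  ⟦⟧-+ : ∀ m n → ⟦ m ℤ.+ n ⟧ ≈ ⟦ m ⟧ + ⟦ n ⟧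
  ⟦⟧-+ m n = pointwise² (λ _ → ≡.refl) (λ _ → ≡.refl)

  ⟦⟧-* : ∀ m n → ⟦ m ℤ.* n ⟧ ≈ ⟦ m ⟧ * ⟦ n ⟧
  ⟦⟧-* m n = pointwise² (λ j → eq m n (residue d j)) (λ _ → eq′ m n)
    where
    eq : ∀ m n δ → m ℤ.* n ≡ m ℤ.* n ℤ.+ 0ℤ ℤ.* 0ℤ ℤ.* δ
    eq = solve-∀
    eq′ : ∀ m n → 0ℤ ≡ m ℤ.* 0ℤ ℤ.+ 0ℤ ℤ.* n
    eq′ = solve-∀

  ⟦⟧-neg : ∀ n → ⟦ ℤ.- n ⟧ ≈ 𝓞.- ⟦ n ⟧
  ⟦⟧-neg n = pointwise² (λ _ → ≡.refl) (λ _ → ≡.refl)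

  -- Here `π` is `pᵒ` by definition, so congruence modulo `π ^ n` is membership of the difference in
  -- `p^ [ n ] ·𝒪`.
  open Adic 𝒪-ring ⟦_⟧ ⟦⟧-+ ⟦⟧-* ⟦⟧-neg 𝓞.refl 𝓞.refl p public
  open import Relation.Binary.Reasoning.Setoid 𝓞.setoid

  p^n*w≈ : ∀ n w → pᵒ ^ n * w ≈ (p^[ n ] Zp.* rat w) +√ (p^[ n ] Zp.* irr w)
  p^n*w≈ n w = 𝓞.trans (𝓞.*-congʳ (p^n≈ n)) (scale (+ (p ℕ.^ n)) w)
    where
    eq₁ : ∀ q x y δ → q ℤ.* x ℤ.+ 0ℤ ℤ.* y ℤ.* δ ≡ q ℤ.* x
    eq₁ = solve-∀
    eq₂ : ∀ q x y → q ℤ.* y ℤ.+ 0ℤ ℤ.* x ≡ q ℤ.* y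
    eq₂ = solve-∀
    scale : ∀ q w → embed (fromℤ q) * w ≈ (fromℤ q Zp.* rat w) +√ (fromℤ q Zp.* irr w)
    scale q w = mk≈
      (pointwise λ j → eq₁ q (residue (rat w) j) (residue (irr w) j) (residue d j))
      (pointwise λ j → eq₂ q (residue (rat w) j) (residue (irr w) j))
    p^n≈ : ∀ n → pᵒ ^ n ≈ embed p^[ n ]
    p^n≈ zero    = 𝓞.refl
    p^n≈ (suc n) = 𝓞.trans (𝓞.*-congˡ (p^n≈ n)) (𝓞.trans (scale (+ p) (embed p^[ n ]))
      (mk≈ (pointwise λ _ → ≡.sym (ℤ.pos-* p (p ℕ.^ n))) (pointwise λ _ → ℤ.*-zeroʳ (+ p))))

  ∈p^⇒∣residue : ∀ n {z} → z ∈ p^ [ n ] ·𝒪 → + (p ℕ.^ n) ∣ residue (rat z) n × + (p ℕ.^ n) ∣ residue (irr z) n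
  ∈p^⇒∣residue n (w , z≈) =
    factor⇒∣residue n (rat w) (rat-≈ z≈p^n*w) , factor⇒∣residue n (irr w) (irr-≈ z≈p^n*w)
    where z≈p^n*w = 𝓞.trans z≈ (p^n*w≈ n w)

  ∣residue⇒∈p^ : ∀ n {z} → + (p ℕ.^ n) ∣ residue (rat z) n → + (p ℕ.^ n) ∣ residue (irr z) n → z ∈ p^ [ n ] ·𝒪
  ∣residue⇒∈p^ n {z} h k =
    let x , eq = ∣residue⇒factor n (rat z) h
        y , eq′ = ∣residue⇒factor n (irr z) k
    in (x +√ y) , 𝓞.trans (mk≈ eq eq′) (𝓞.sym (p^n*w≈ n (x +√ y)))

  ∈p^⇒≡ : ∀ z w n → z - w ∈ p^ [ n ] ·𝒪 → z ≡ w [π^ n ]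
  ∈p^⇒≡ z w n (s , eq) = mk≡ s eq

  ≡⇒∈p^ : ∀ {z w n} → z ≡ w [π^ n ] → z - w ∈ p^ [ n ] ·𝒪
  ≡⇒∈p^ (mk≡ s eq) = s , eq

  -≈0⇒≡ : ∀ z w n → z - w ≈ 0# → z ≡ w [π^ n ]
  -≈0⇒≡ z w n z-w≈0 = mk≡ 0# (𝓞.trans z-w≈0 (𝓞.sym (𝓞.zeroʳ (pᵒ ^ n))))

  p^n-torsionFree-𝒪 : ∀ n {z} → pᵒ ^ n * z ≈ 0# → z ≈ 0#
  p^n-torsionFree-𝒪 n {z} h = mk≈ (p^n-torsionFree n (rat z) (rat-≈ h′)) (p^n-torsionFree n (irr z) (irr-≈ h′))
    where h′ = 𝓞.trans (𝓞.sym (p^n*w≈ n z)) h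

  -- The norm and the group `U⁰`.

  norm-cong : ∀ {z w} → z ≈ w → norm z Zp.≈ norm w
  norm-cong (mk≈ h k) = Zp.+-cong (Zp.*-cong h h) (Zp.-‿cong (Zp.*-congʳ (Zp.*-cong k k)))

  norm-* : ∀ z w → norm (z * w) Zp.≈ norm z Zp.* norm w
  norm-* z w = pointwise λ n →
    eq (residue (rat z) n) (residue (irr z) n) (residue (rat w) n) (residue (irr w) n) (residue d n)
    where
    eq : ∀ x y x′ y′ δ →
         (x ℤ.* x′ ℤ.+ y ℤ.* y′ ℤ.* δ) ℤ.* (x ℤ.* x′ ℤ.+ y ℤ.* y′ ℤ.* δ)
           ℤ.- (x ℤ.* y′ ℤ.+ y ℤ.* x′) ℤ.* (x ℤ.* y′ ℤ.+ y ℤ.* x′) ℤ.* δ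
         ≡ (x ℤ.* x ℤ.- y ℤ.* y ℤ.* δ) ℤ.* (x′ ℤ.* x′ ℤ.- y′ ℤ.* y′ ℤ.* δ)
    eq = solve-∀

  norm-1 : norm 1# Zp.≈ Zp.1#
  norm-1 = pointwise λ n → eq (residue d n)
    where
    eq : ∀ δ → 1ℤ ℤ.* 1ℤ ℤ.- 0ℤ ℤ.* 0ℤ ℤ.* δ ≡ 1ℤ
    eq = solve-∀

  -- Each coordinate contributes a difference of squares, a multiple of the difference of the
  -- coordinates.
  norm-residue : ∀ n {z w} → z ≡ w [π^ n ] → + (p ℕ.^ n) ∣ residue (norm z) n ℤ.- residue (norm w) n
  norm-residue n {z} {w} z≡w = let h , k = ∈p^⇒∣residue n {z - w} (≡⇒∈p^ z≡w) in
    ∣-resp (eq (residue (rat z) n) (residue (irr z) n) (residue (rat w) n) (residue (irr w) n) (residue d n))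
      (∣m∣n⇒∣m-n (∣m⇒∣m*n (residue (rat z) n ℤ.+ residue (rat w) n) h)
                 (∣m⇒∣m*n ((residue (irr z) n ℤ.+ residue (irr w) n) ℤ.* residue d n) k))
    where
    eq : ∀ x y x′ y′ δ → (x ℤ.- x′) ℤ.* (x ℤ.+ x′) ℤ.- (y ℤ.- y′) ℤ.* ((y ℤ.+ y′) ℤ.* δ)
       ≡ (x ℤ.* x ℤ.- y ℤ.* y ℤ.* δ) ℤ.- (x′ ℤ.* x′ ℤ.- y′ ℤ.* y′ ℤ.* δ)
    eq = solve-∀

  -- Wrapped in a record so that `z` stays visible to unification; `norm z` itself unfolds into
  -- coordinates.
  record NormOne (z : 𝒪) : Set where
    constructor normOne
    field
      norm≈1 : norm z Zp.≈ Zp.1#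

  open NormOne public

  NormOne-1 : NormOne 1#
  NormOne-1 = normOne norm-1

  NormOne-resp : ∀ {z w} → z ≈ w → NormOne z → NormOne w
  NormOne-resp z≈w (normOne h) = normOne (Zp.trans (Zp.sym (norm-cong z≈w)) h)

  NormOne-* : ∀ {z w} → NormOne z → NormOne w → NormOne (z * w)
  NormOne-* {z} {w} (normOne h) (normOne k) =
    normOne (Zp.trans (norm-* z w) (Zp.trans (Zp.*-cong h k) (Zp.*-identityˡ Zp.1#)))

  NormOne-^ : ∀ {z} n → NormOne z → NormOne (z ^ n)
  NormOne-^ zero    h = NormOne-1
  NormOne-^ {z} (suc n) h = NormOne-* {z} {z ^ n} h (NormOne-^ {z} n h)

  NormOne-inverse : ∀ {z w} → z * w ≈ 1# → NormOne z → NormOne w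
  NormOne-inverse {z} {w} zw≈1 (normOne h) =
    normOne (Zp.trans (Zp.sym (Zp.*-identityˡ (norm w))) (Zp.trans (Zp.*-congʳ (Zp.sym h))
      (Zp.trans (Zp.sym (norm-* z w)) (Zp.trans (norm-cong zw≈1) norm-1))))

  -1*-1≈1 : (Zp.- Zp.1#) Zp.* (Zp.- Zp.1#) Zp.≈ Zp.1#
  -1*-1≈1 = pointwise λ _ → ≡.refl

  conj : 𝒪 → 𝒪
  conj z = rat z +√ (Zp.- irr z)

  z*conj : ∀ z → z * conj z ≈ embed (norm z)
  z*conj z = mk≈
    (pointwise λ n → eq (residue (rat z) n) (residue (irr z) n) (residue d n))
    (pointwise λ n → eq′ (residue (rat z) n) (residue (irr z) n))
    where
    eq : ∀ x y δ → x ℤ.* x ℤ.+ y ℤ.* (ℤ.- y) ℤ.* δ ≡ x ℤ.* x ℤ.- y ℤ.* y ℤ.* δ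
    eq = solve-∀
    eq′ : ∀ x y → x ℤ.* (ℤ.- y) ℤ.+ y ℤ.* x ≡ 0ℤ
    eq′ = solve-∀

  -- The conjugate, up to the sign of the norm, is an inverse; membership in `U⁰` thus comes down to
  -- the norm.
  norm±1⇒U⁰ : ∀ {z} → norm z Zp.≈ Zp.1# ⊎ norm z Zp.≈ Zp.- Zp.1# → z ∈ U⁰
  norm±1⇒U⁰ {z} h = (proj₁ inv , 𝓞.trans (𝓞.*-comm (proj₁ inv) z) (proj₂ inv) , proj₂ inv) , h
    where
    inverse : norm z Zp.≈ Zp.1# ⊎ norm z Zp.≈ Zp.- Zp.1# → ∃[ w ] z * w ≈ 1#
    inverse (inj₁ N≈1)  = conj z , 𝓞.trans (z*conj z) (mk≈ N≈1 Zp.refl)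
    inverse (inj₂ N≈-1) = 𝓞.- conj z , (begin
      z * (𝓞.- conj z)      ≈⟨ RingProperties.-‿distribʳ-* 𝓞.ring z (conj z) ⟨
      𝓞.- (z * conj z)      ≈⟨ 𝓞.-‿cong (𝓞.trans (z*conj z) (mk≈ N≈-1 Zp.refl)) ⟩
      𝓞.- embed (Zp.- Zp.1#) ≈⟨ mk≈ (pointwise λ _ → ≡.refl) (pointwise λ _ → ≡.refl) ⟩
      1#                    ∎)
    inv = inverse h

  U⁰-* : ∀ {z w} → z ∈ U⁰ → w ∈ U⁰ → z * w ∈ U⁰
  U⁰-* {z} {w} (_ , h) (_ , k) = norm±1⇒U⁰ (sign h k)
    where
    sign : norm z Zp.≈ Zp.1# ⊎ norm z Zp.≈ Zp.- Zp.1# → norm w Zp.≈ Zp.1# ⊎ norm w Zp.≈ Zp.- Zp.1# →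
           norm (z * w) Zp.≈ Zp.1# ⊎ norm (z * w) Zp.≈ Zp.- Zp.1#
    sign (inj₁ h) (inj₁ k) = inj₁ (norm≈1 (NormOne-* {z} {w} (normOne h) (normOne k)))
    sign (inj₁ h) (inj₂ k) = inj₂ (Zp.trans (norm-* z w) (Zp.trans (Zp.*-cong h k) (Zp.*-identityˡ _)))
    sign (inj₂ h) (inj₁ k) = inj₂ (Zp.trans (norm-* z w) (Zp.trans (Zp.*-cong h k) (Zp.*-identityʳ _)))
    sign (inj₂ h) (inj₂ k) = inj₁ (Zp.trans (norm-* z w) (Zp.trans (Zp.*-cong h k) -1*-1≈1))

  U⁰-^ : ∀ {z} n → z ∈ U⁰ → z ^ n ∈ U⁰
  U⁰-^ zero    h = norm±1⇒U⁰ (inj₁ norm-1)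
  U⁰-^ {z} (suc n) h = U⁰-* {z} {z ^ n} h (U⁰-^ {z} n h)

  U⁰-inverse : ∀ {z w} → z * w ≈ 1# → z ∈ U⁰ → w ∈ U⁰
  U⁰-inverse {z} {w} zw≈1 (_ , h) = norm±1⇒U⁰
    (Sum.map (λ k → norm≈1 (NormOne-inverse {z} {w} zw≈1 (normOne k))) sign h)
    where
    sign : norm z Zp.≈ Zp.- Zp.1# → norm w Zp.≈ Zp.- Zp.1#
    sign k = Zp.trans (Zp.sym (Zp.*-identityˡ (norm w))) (Zp.trans (Zp.*-congʳ (Zp.sym -1*-1≈1))
      (Zp.trans (Zp.*-assoc _ _ _) (Zp.trans (Zp.*-congˡ (Zp.trans (Zp.*-congʳ (Zp.sym k))
        (Zp.trans (Zp.sym (norm-* z w)) (Zp.trans (norm-cong zw≈1) norm-1)))) (Zp.*-identityʳ _))))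

  -- The approximants may have norms of varying sign; `±1-limit` settles one sign for the limit.
  U⁰-limit : ∀ {z} → (∀ n → ∃[ s ] s ∈ U⁰ × s ≡ z [π^ n ]) → z ∈ U⁰
  U⁰-limit {z} approx = norm±1⇒U⁰ (±1-limit (norm z) λ n →
    let s , (_ , Ns≈±1) , s≡z = approx n in
    Sum.map (λ h → step n {s} h s≡z) (λ h → step n {s} h s≡z) Ns≈±1)
    where
    eq : ∀ a b c → (b ℤ.- c) ℤ.- (b ℤ.- a) ≡ a ℤ.- c
    eq = solve-∀
    step : ∀ n {s c} → norm s Zp.≈ c → s ≡ z [π^ n ] →
           + (p ℕ.^ n) ∣ residue (norm z) n ℤ.- residue c n
    step n {s} {c} Ns≈c s≡z = ∣-resp (eq (residue (norm z) n) (residue (norm s) n) (residue c n))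
      (∣m∣n⇒∣m-n (p^n∣x-y (residue-≡ Ns≈c n)) (norm-residue n s≡z))

  -- The norm is then 1 modulo `p`, which differs from -1 because `p` is odd. This gives `a ^ l`
  -- norm one whatever the norm of `a`.
  ≡1⇒NormOne : ∀ {z} → z ∈ U⁰ → z ≡ 1# [π^ 1 ] → NormOne z
  ≡1⇒NormOne (_ , inj₁ N≈1) z≡1 = normOne N≈1
  ≡1⇒NormOne {z} (_ , inj₂ N≈-1) z≡1 = contradiction
    (p^1∣⇒p∣ (∣-resp (eq (residue (norm z) 1) (residue (norm 1#) 1))
      (∣m∣n⇒∣m-n (∣m∣n⇒∣m-n (p^n∣x-y (residue-≡ N≈-1 1)) (p^n∣x-y (residue-≡ norm-1 1)))
                 (norm-residue 1 z≡1)))) p∤2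
    where
    eq : ∀ a b → ((a ℤ.- (ℤ.- 1ℤ)) ℤ.- (b ℤ.- 1ℤ)) ℤ.- (a ℤ.- b) ≡ + 2
    eq = solve-∀

  ≡-separated : ∀ {z w} → (∀ n → z ≡ w [π^ n ]) → z - w ≈ 0#
  ≡-separated {z} {w} z≡w = mk≈
    (PAdic.mk≈ λ n → PAdic.mk≡ (∣-resp (eq (residue (rat (z - w)) n)) (proj₁ (∈p^⇒∣residue n {z - w} (≡⇒∈p^ (z≡w n))))))
    (PAdic.mk≈ λ n → PAdic.mk≡ (∣-resp (eq (residue (irr (z - w)) n)) (proj₂ (∈p^⇒∣residue n {z - w} (≡⇒∈p^ (z≡w n))))))
    where
    eq : ∀ a → a ≡ a ℤ.- 0ℤ
    eq = solve-∀

  -- Norm-one elements modulo powers of `p`.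

  -- Expanding N(1 + pᵉ (x + y √d)) = 1 gives 2x = - pᵉ (x² - d y²).
  NormOne⇒p∣rat : ∀ {u} e → NormOne u → ∀ {w} → u - 1# ≈ pᵒ ^ suc e * w → + p ∣ residue (rat w) 1
  NormOne⇒p∣rat {u} e (normOne N≈1) {w} eq =
    p^1∣⇒p∣ (∣-lower (rat w) 1 (suc e)
      (p∣⇒p^1∣ (subst (λ n → + p ∣ residue (rat w) n) (ℕ.+-comm 1 (suc e)) p∣X)))
    where
    E = suc e
    û = 1# + ((p^[ E ] Zp.* rat w) +√ (p^[ E ] Zp.* irr w))
    u≈û : u ≈ û
    u≈û = 𝓞.trans (x-1≈y⇒x≈1+y eq) (𝓞.+-congˡ (p^n*w≈ E w))
    Nû≈1 : norm û Zp.≈ Zp.1#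
    Nû≈1 = Zp.trans (Zp.sym (norm-cong u≈û)) N≈1
    q = + (p ℕ.^ E)
    -- Residues are taken at `suc E`, so that one factor `p` survives the cancellation of `q`.
    X = residue (rat w) (suc E)
    Y = residue (irr w) (suc E)
    δ = residue d (suc E)
    eq₁ : ∀ q X Y δ → (1ℤ ℤ.+ q ℤ.* X) ℤ.* (1ℤ ℤ.+ q ℤ.* X) ℤ.- (0ℤ ℤ.+ q ℤ.* Y) ℤ.* (0ℤ ℤ.+ q ℤ.* Y) ℤ.* δ ℤ.- 1ℤ
          ≡ (+ 2 ℤ.* X ℤ.+ q ℤ.* (X ℤ.* X ℤ.- Y ℤ.* Y ℤ.* δ)) ℤ.* q
    eq₁ = solve-∀
    p∣sum : + p ∣ + 2 ℤ.* X ℤ.+ q ℤ.* (X ℤ.* X ℤ.- Y ℤ.* Y ℤ.* δ)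
    p∣sum = *-cancelʳ-∣ q {{p^n≢0 E}}
      (subst₂ _∣_ (ℤ.pos-* p (p ℕ.^ E)) (eq₁ q X Y δ) (p^n∣x-y (residue-≡ Nû≈1 (suc E))))
    p∣X : + p ∣ X
    p∣X = euclidʳ (+ 2) p∤2 (∣m+n∣n⇒∣m p∣sum (∣m⇒∣m*n (X ℤ.* X ℤ.- Y ℤ.* Y ℤ.* δ) (p∣p^1+n e)))

  -- Modulo `p` both leading coefficients are multiples of `√d`, and exactness makes that of `u`
  -- nonzero. The exponent is the quotient of the irrational parts.
  NormOne-approx : ∀ {u v} e → NormOne u → NormOne v → Exact u (suc e) → v ≡ 1# [π^ suc e ] →
                   ∃[ t ] v ≡ u ^ t [π^ suc (suc e) ]
  NormOne-approx {u} {v} e Nu Nv exact@(mk≡ w eq , _) (mk≡ w′ eq′) =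
    let t , _ , p∣y′-ty = ∤⇒quotient (residue (irr w) 1) (residue (irr w′) 1) p∤y
    in t , ≡-^-refine {u} {v} {w} {w′} e t eq eq′ (divisible t p∣y′-ty)
    where
    p∣x = NormOne⇒p∣rat {u} e Nu {w} eq
    p∣x′ = NormOne⇒p∣rat {v} e Nv {w′} eq′

    p∤y : ¬ + p ∣ residue (irr w) 1
    p∤y p∣y = let w₁ , w≈pw₁ = ∣residue⇒∈p^ 1 {w} (p∣⇒p^1∣ p∣x) (p∣⇒p^1∣ p∣y) in
      Exact⇒π∤ {u} {w} {w₁} {suc e} exact eq w≈pw₁

    eq₁ : ∀ x′ t x y δ → x′ ℤ.- t ℤ.* x ≡ x′ ℤ.- (t ℤ.* x ℤ.+ 0ℤ ℤ.* y ℤ.* δ)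
    eq₁ = solve-∀
    eq₂ : ∀ y′ t x y → y′ ℤ.- t ℤ.* y ≡ y′ ℤ.- (t ℤ.* y ℤ.+ 0ℤ ℤ.* x)
    eq₂ = solve-∀

    divisible : ∀ t → + p ∣ residue (irr w′) 1 ℤ.- + t ℤ.* residue (irr w) 1 →
                w′ ≡ ⟦ + t ⟧ * w [π^ 1 ]
    divisible t h = ∈p^⇒≡ w′ (⟦ + t ⟧ * w) 1 (∣residue⇒∈p^ 1 {w′ - ⟦ + t ⟧ * w}
      (p∣⇒p^1∣ (∣-resp (eq₁ (residue (rat w′) 1) (+ t) (residue (rat w) 1) (residue (irr w) 1) (residue d 1))
                       (∣m∣n⇒∣m-n p∣x′ (∣n⇒∣m*n (+ t) p∣x))))
      (p∣⇒p^1∣ (∣-resp (eq₂ (residue (irr w′) 1) (+ t) (residue (rat w) 1) (residue (irr w) 1)) h)))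

  -- There are `p + 2` elements but only `p + 1` slopes, and the slope determines the class modulo
  -- `p`. That `d` is a unit gives `p∤δ`.
  NormOne-pigeonhole : IsUnit p d → (f : Fin (suc (suc p)) → 𝒪) → (∀ i → NormOne (f i)) →
                       ∃[ i ] ∃[ j ] i Fin.< j × f i ≡ f j [π^ 1 ]
  NormOne-pigeonhole (d⁻¹ , _ , dd⁻¹≈1) f Nf =
    let i , j , i<j , same = Fin.pigeonhole ℕ.≤-refl (λ i → proj₁ (slopeOf i))
        h , k = slope-injective p∤δ {x i} {y i} {x j} {y j} {proj₁ (slopeOf i)}
                  (onConic i) (onConic j) (proj₂ (slopeOf i))
                  (subst (λ t → IsSlope t (x j) (y j)) (≡.sym same) (proj₂ (slopeOf j)))
    in i , j , i<j , ∈p^⇒≡ (f i) (f j) 1 (∣residue⇒∈p^ 1 {f i - f j} (p∣⇒p^1∣ h) (p∣⇒p^1∣ k))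
    where
    δ = residue d 1
    x y : Fin (suc (suc p)) → ℤ
    x i = residue (rat (f i)) 1
    y i = residue (irr (f i)) 1
    slopeOf : ∀ i → ∃[ t ] IsSlope t (x i) (y i)
    slopeOf i = slope (x i) (y i)
    onConic : ∀ i → OnConic δ (x i) (y i)
    onConic i = p^1∣⇒p∣ (p^n∣x-y (residue-≡ (norm≈1 (Nf i)) 1))
    eq : ∀ δ ε → δ ℤ.* ε ℤ.- (δ ℤ.* ε ℤ.- 1ℤ) ≡ 1ℤ
    eq = solve-∀
    p∤δ : ¬ + p ∣ δ
    p∤δ p∣δ = p∤1 (∣-resp (eq δ (residue d⁻¹ 1))
      (∣m∣n⇒∣m-n (∣m⇒∣m*n (residue d⁻¹ 1) p∣δ) (p^1∣⇒p∣ (p^n∣x-y (residue-≡ dd⁻¹≈1 1)))))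

  closure-idem : ∀ {ℓ} {S : Pred 𝒪 ℓ} → closure (closure S) ⊆ closure S
  closure-idem {x = z} z∈ m =
    let s , s∈ , s≡z = z∈ m
        t , t∈ , t≡s = s∈ m
    in t , t∈ , ≡⇒∈p^ (≡-trans m (∈p^⇒≡ t s m t≡s) (∈p^⇒≡ s z m s≡z))

-- The closed subgroup generated by `a`.

module ClosureOfPowers (p : ℕ) (pp : Prime p) (3≤p : 3 ≤ p) (d : ℤₚ p)
                       (a : ℤₚ[√d].𝒪 d) (l : ℕ) (a∈U⁰ : a ∈ ℤₚ[√d].U⁰ d)
                       (order : ℤₚ[√d].HasOrderModP d a l) where

  open ℤₚ[√d] d
  open Padic p pp 3≤p using (module Zp)
  open ModPrime p pp 3≤p using (p-odd)
  open QuadraticExtension p pp 3≤p d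
  open HasOrderModP order

  a⁻¹ : 𝒪
  a⁻¹ = proj₁ (proj₁ a∈U⁰)

  aa⁻¹≈1 : a * a⁻¹ ≈ 1#
  aa⁻¹≈1 = proj₂ (proj₂ (proj₁ a∈U⁰))

  a⁻¹∈U⁰ : a⁻¹ ∈ U⁰
  a⁻¹∈U⁰ = U⁰-inverse aa⁻¹≈1 a∈U⁰

  a^l≡1 : a ^ l ≡ 1# [π^ 1 ]
  a^l≡1 = ∈p^⇒≡ (a ^ l) 1# 1 period

  a^m≡1⇒l≤m : ∀ m → 1 ≤ m → a ^ m ≡ 1# [π^ 1 ] → l ≤ m
  a^m≡1⇒l≤m m 1≤m a^m≡1 = least m 1≤m (≡⇒∈p^ a^m≡1)

  ν⇒Exact : ∀ k → ν (a ^ l - 1#) is [ k ] → Exact (a ^ l) k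
  ν⇒Exact k (a^l≡1 , a^l≢1) = ∈p^⇒≡ (a ^ l) 1# k a^l≡1 , λ h → a^l≢1 (≡⇒∈p^ h)

  open Order {a} {a⁻¹} {l} aa⁻¹≈1 positive a^l≡1 a^m≡1⇒l≤m

  ⟨a⟩ : Pred 𝒪 _
  ⟨a⟩ = closure (powers a)

  ∈⟨a⟩⇒≡ : ∀ {z} → z ∈ ⟨a⟩ → ∀ m → ∃[ n ] a ^ n ≡ z [π^ m ]
  ∈⟨a⟩⇒≡ {z} z∈ m =
    let s , (n , s≈a^n) , s≡z = z∈ m in n , ≡-trans m (≈⇒≡ m (𝓞.sym s≈a^n)) (∈p^⇒≡ s z m s≡z)

  ≡⇒∈⟨a⟩ : ∀ {z} → (∀ m → ∃[ n ] a ^ n ≡ z [π^ m ]) → z ∈ ⟨a⟩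
  ≡⇒∈⟨a⟩ h m = let n , a^n≡z = h m in a ^ n , (n , 𝓞.refl) , ≡⇒∈p^ a^n≡z

  ⟨a⟩⊆U⁰ : ⟨a⟩ ⊆ U⁰
  ⟨a⟩⊆U⁰ z∈ = U⁰-limit λ m → let n , a^n≡z = ∈⟨a⟩⇒≡ z∈ m in a ^ n , U⁰-^ n a∈U⁰ , a^n≡z

  ⟨a⟩-* : ∀ {z w} → z ∈ ⟨a⟩ → w ∈ ⟨a⟩ → z * w ∈ ⟨a⟩
  ⟨a⟩-* z∈ w∈ = ≡⇒∈⟨a⟩ λ m →
    let i , a^i≡z = ∈⟨a⟩⇒≡ z∈ m
        j , a^j≡w = ∈⟨a⟩⇒≡ w∈ m
    in i ℕ.+ j , ≡-trans m (≈⇒≡ m (^-homo-* a i j)) (*-cong-≡ m a^i≡z a^j≡w)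

  ⟨a⟩-⁻¹ : ∀ {z w} → z ∈ ⟨a⟩ → z * w ≈ 1# → w ∈ ⟨a⟩
  ⟨a⟩-⁻¹ {z} {w} z∈ zw≈1 = ≡⇒∈⟨a⟩ λ m →
    let n , a^n≡z = ∈⟨a⟩⇒≡ z∈ m
        h , p≡1+2h = p-odd
        j , a^j*a^n≡1 = ^-inverse h p≡1+2h m n
        wz≈1 = 𝓞.trans (𝓞.*-comm w z) zw≈1
    -- Both `a ^ j` and `w` invert `z` to precision `m`, so cancelling `z` identifies them.
    in j , ≡-cancelʳ m zw≈1 (≡-trans m (*-congˡ-≡ (a ^ j) m (≡-sym m a^n≡z))
                              (≡-trans m a^j*a^n≡1 (≈⇒≡ m (𝓞.sym wz≈1))))

  ⟨a⟩-isGenerated : ∀ {ℓ} → IsClosedSubgroupGeneratedBy ℓ a ⟨a⟩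
  ⟨a⟩-isGenerated = record
    { isClosedSubgroup = record
      { ⊆U⁰       = ⟨a⟩⊆U⁰
      ; 1∈        = ≡⇒∈⟨a⟩ λ m → 0 , ≈⇒≡ m 𝓞.refl
      ; *-closed  = ⟨a⟩-*
      ; ⁻¹-closed = ⟨a⟩-⁻¹
      ; closed    = λ (z∈ , _) → closure-idem z∈
      }
    ; generator = ≡⇒∈⟨a⟩ λ m → 1 , ≈⇒≡ m (𝓞.*-identityʳ a)
    ; least     = λ T T-closed a∈T z∈ →
        let open IsClosedSubgroupOfU⁰ T-closed
            a^n∈T : ∀ n → a ^ n ∈ T
            a^n∈T = ^∈ T T-closed a∈T
        -- Closedness of `T` is relative to `U⁰`, hence the second component.
        in closed ((λ m → let n , a^n≡z = ∈⟨a⟩⇒≡ z∈ m in a ^ n , a^n∈T n , ≡⇒∈p^ a^n≡z) , ⟨a⟩⊆U⁰ z∈)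
    }
    where
    ^∈ : ∀ {ℓ} (T : Pred 𝒪 ℓ) → IsClosedSubgroupOfU⁰ T → a ∈ T → ∀ n → a ^ n ∈ T
    ^∈ T T-closed a∈T zero    = IsClosedSubgroupOfU⁰.1∈ T-closed
    ^∈ T T-closed a∈T (suc n) = IsClosedSubgroupOfU⁰.*-closed T-closed a∈T (^∈ T T-closed a∈T n)

  -- Dividing by `a ^ n` moves `z` next to `1#`, where membership in `U⁰` forces norm one; so
  -- density applies even if `z` has norm -1. Both the coset description and the full-order case
  -- rest on this.
  ≡a^n⇒∈⟨a⟩ : ∀ e → Exact (a ^ l) (suc e) → ∀ {z} n → z ∈ U⁰ → z ≡ a ^ n [π^ suc e ] → z ∈ ⟨a⟩
  ≡a^n⇒∈⟨a⟩ e exact {z} n z∈U⁰ z≡a^n = ≡⇒∈⟨a⟩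
    (let h , p≡1+2h = p-odd in
     Exact⇒dense-coset NormOne NormOne-1 NormOne-* NormOne-approx p^n-torsionFree-𝒪 h p≡1+2h
       {a} {a⁻¹} {z} l n e aa⁻¹≈1 N[a^l]≈1 N[a⁻¹^l]≈1 exact
       N[za⁻¹^n]≈1 z≡a^n)
    where
    N[a^l]≈1 : NormOne (a ^ l)
    N[a^l]≈1 = ≡1⇒NormOne {a ^ l} (U⁰-^ l a∈U⁰) a^l≡1
    N[a⁻¹^l]≈1 : NormOne (a⁻¹ ^ l)
    N[a⁻¹^l]≈1 = NormOne-inverse {a ^ l} {a⁻¹ ^ l} (inverse-^ l aa⁻¹≈1) N[a^l]≈1
    N[za⁻¹^n]≈1 : NormOne (z * a⁻¹ ^ n)
    N[za⁻¹^n]≈1 = ≡1⇒NormOne {z * a⁻¹ ^ n} (U⁰-* {z} {a⁻¹ ^ n} z∈U⁰ (U⁰-^ {a⁻¹} n a⁻¹∈U⁰))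
      (≡-trans 1 (*-congʳ-≡ (a⁻¹ ^ n) 1 (≡-weaken (s≤s z≤n) z≡a^n)) (≈⇒≡ 1 (inverse-^ n aa⁻¹≈1)))

  -- The decomposition into cosets.

  UnionOfCosets : ℕ ⁺ → Pred 𝒪 _
  UnionOfCosets k = ⋃[ i ∶ Fin l ] (coset (a ^ toℕ i) k ∩ U⁰)

  a^mod : ∀ n → a ^ toℕ (n mod l) ≈ a ^ (n % l)
  a^mod n = ^-congʳ a (Fin.toℕ-fromℕ< (m%n<n n l))

  ⟨a⟩⊆cosets : ∀ k → ν (a ^ l - 1#) is k → ⟨a⟩ ⊆ UnionOfCosets k
  ⟨a⟩⊆cosets [ k ] ν≡k {z} z∈ =
    let n , a^n≡z = ∈⟨a⟩⇒≡ z∈ k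
        a^l≡1 , _ = ν⇒Exact k ν≡k
    in n mod l
     , ≡⇒∈p^ (≡-trans k (≡-sym k a^n≡z) (≡-trans k (^-% k n a^l≡1) (≈⇒≡ k (𝓞.sym (a^mod n)))))
     , ⟨a⟩⊆U⁰ z∈
  -- If `a ^ l` equals `1#`, the exponents approximating `z` may still vary with the precision, but
  -- their remainders modulo `l` are already determined modulo `p`. Hence `z` is a single power of
  -- `a`.
  ⟨a⟩⊆cosets ⊤⁺ a^l-1≈0 {z} z∈ = n₁ mod l , ≡-separated {z} {a ^ toℕ (n₁ mod l)} z≡ , ⟨a⟩⊆U⁰ z∈
    where
    n₁ = proj₁ (∈⟨a⟩⇒≡ z∈ 1)
    z≡ : ∀ m → z ≡ a ^ toℕ (n₁ mod l) [π^ m ]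
    z≡ m =
      -- Precision `suc m` allows the comparison modulo `π` even when `m` is 0.
      let n , a^n≡z = ∈⟨a⟩⇒≡ z∈ (suc m)
          a^n≡a^n₁ = ≡-trans 1 (≡-weaken (s≤s z≤n) a^n≡z) (≡-sym 1 (proj₂ (∈⟨a⟩⇒≡ z∈ 1)))
          n%l≡n₁%l = ^-injective (m%n<n n l) (m%n<n n₁ l)
            (≡-trans 1 (≡-sym 1 (^-% 1 n a^l≡1)) (≡-trans 1 a^n≡a^n₁ (^-% 1 n₁ a^l≡1)))
      in ≡-trans m (≡-sym m (≡-weaken (ℕ.n≤1+n m) a^n≡z))
           (≡-trans m (^-% m n (-≈0⇒≡ (a ^ l) 1# m a^l-1≈0))
             (≈⇒≡ m (𝓞.trans (^-congʳ a n%l≡n₁%l) (𝓞.sym (a^mod n₁)))))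

  cosets⊆⟨a⟩ : ∀ k → ν (a ^ l - 1#) is k → UnionOfCosets k ⊆ ⟨a⟩
  -- Valuation 0 contradicts the period, since `a ^ l` is `1#` modulo `p`.
  cosets⊆⟨a⟩ [ zero ]  (_ , a^l≢1) _ = contradiction period a^l≢1
  cosets⊆⟨a⟩ [ suc e ] ν≡k {z} (i , z≡a^i , z∈U⁰) =
    ≡a^n⇒∈⟨a⟩ e (ν⇒Exact (suc e) ν≡k) (toℕ i) z∈U⁰ (∈p^⇒≡ z (a ^ toℕ i) (suc e) z≡a^i)
  cosets⊆⟨a⟩ ⊤⁺ _ {z} (i , z-a^i≈0 , _) = ≡⇒∈⟨a⟩ λ m →
    toℕ i , ≡-sym m (-≈0⇒≡ z (a ^ toℕ i) m z-a^i≈0)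

  -- As `k` is at least one, a coset lies in a single class modulo `p`, and the powers below `l`
  -- have distinct classes.
  cosets-disjoint : ∀ k → ν (a ^ l - 1#) is k → ∀ (i j : Fin l) → i ≢ j →
                    (coset (a ^ toℕ i) k ∩ U⁰) ⊥ (coset (a ^ toℕ j) k ∩ U⁰)
  cosets-disjoint k ν≡k i j i≢j {z} ((z≡a^i , _) , (z≡a^j , _)) =
    i≢j (Fin.toℕ-injective (^-injective (Fin.toℕ<n i) (Fin.toℕ<n j)
      (≡-trans 1 (≡-sym 1 (mod-p k ν≡k z (a ^ toℕ i) z≡a^i)) (mod-p k ν≡k z (a ^ toℕ j) z≡a^j))))
    where
    mod-p : ∀ k → ν (a ^ l - 1#) is k → ∀ z w → z ∈ coset w k → z ≡ w [π^ 1 ]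
    mod-p [ zero ]  (_ , a^l≢1) _ _ _ = contradiction period a^l≢1
    mod-p [ suc k ] _ z w z≡w   = ≡-weaken (s≤s z≤n) (∈p^⇒≡ z w (suc k) z≡w)
    mod-p ⊤⁺        _ z w z-w≈0 = -≈0⇒≡ z w 1 z-w≈0

  -- Full order: every class of `U⁰` modulo `p` is a power of `a`.

  module FullOrder (d-unit : IsUnit p d) (l≡2[p+1] : l ≡ 2 ℕ.* (p ℕ.+ 1)) where

    2+p≤l : suc (suc p) ≤ l
    2+p≤l = ≡.subst (suc (suc p) ≤_) (≡.sym (≡.trans l≡2[p+1] (eq p))) (ℕ.m≤n+m (suc (suc p)) p)
      where
      eq : ∀ p → 2 ℕ.* (p ℕ.+ 1) ≡ p ℕ.+ suc (suc p)
      eq = ℕ-Solver.solve-∀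

    -- Otherwise the first `p + 2` powers of `a`, distinct modulo `p` since `l` is large enough,
    -- would all have norm one, against the pigeonhole bound.
    ¬NormOne-a : ¬ NormOne a
    ¬NormOne-a N≈1 =
      let i , j , i<j , a^i≡a^j = NormOne-pigeonhole d-unit (λ i → a ^ toℕ i) (λ i → NormOne-^ (toℕ i) N≈1)
      in ℕ.<⇒≢ i<j (^-injective (<l i) (<l j) a^i≡a^j)
      where
      <l : ∀ (i : Fin (suc (suc p))) → toℕ i ℕ.< l
      <l i = ℕ.<-≤-trans (Fin.toℕ<n i) 2+p≤l

    Na≈-1 : norm a Zp.≈ Zp.- Zp.1#
    Na≈-1 = [ (λ N≈1 → contradiction (normOne N≈1) ¬NormOne-a) , id ]′ (proj₂ a∈U⁰)

    NormOne-*a : ∀ {z} → norm z Zp.≈ Zp.- Zp.1# → NormOne (z * a)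
    NormOne-*a {z} N≈-1 = normOne (Zp.trans (norm-* z a) (Zp.trans (Zp.*-cong N≈-1 Na≈-1) -1*-1≈1))

    -- The element `z` joins the `p + 1` even powers of `a` with exponent below `l`. Those are
    -- distinct modulo `p`, so the collision given by the pigeonhole involves `z`.
    NormOne⇒≡a^n : ∀ {z} → NormOne z → ∃[ n ] z ≡ a ^ n [π^ 1 ]
    NormOne⇒≡a^n {z} Nz = find (NormOne-pigeonhole d-unit f Nf)
      where
      f : Fin (suc (suc p)) → 𝒪
      f zero    = z
      f (suc i) = a ^ (2 ℕ.* toℕ i)
      Nf : ∀ i → NormOne (f i)
      Nf zero    = Nz
      Nf (suc i) = NormOne-resp (^-assocʳ a 2 (toℕ i)) (NormOne-^ (toℕ i)
        (NormOne-resp (𝓞.*-congˡ (𝓞.sym (𝓞.*-identityʳ a))) (NormOne-*a {a} Na≈-1)))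
      2i<l : ∀ (i : Fin (suc p)) → 2 ℕ.* toℕ i ℕ.< l
      2i<l i = ≡.subst (2 ℕ.* toℕ i ℕ.<_) (≡.sym (≡.trans l≡2[p+1] (cong (2 ℕ.*_) (ℕ.+-comm p 1))))
        (ℕ.*-monoʳ-< 2 (Fin.toℕ<n i))
      find : ∃[ i ] ∃[ j ] i Fin.< j × f i ≡ f j [π^ 1 ] → ∃[ n ] z ≡ a ^ n [π^ 1 ]
      find (zero  , suc j , _ , z≡a^2j) = 2 ℕ.* toℕ j , z≡a^2j
      find (suc i , suc j , s≤s i<j , a^2i≡a^2j) = contradiction
        (ℕ.*-cancelˡ-≡ (toℕ i) (toℕ j) 2 (^-injective (2i<l i) (2i<l j) a^2i≡a^2j)) (ℕ.<⇒≢ i<j)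

    -- In the case of norm -1, multiplication by `a` leads back to norm one, and `^-divide` undoes
    -- it.
    U⁰⇒≡a^n : ∀ {z} → z ∈ U⁰ → ∃[ n ] z ≡ a ^ n [π^ 1 ]
    U⁰⇒≡a^n (_ , inj₁ N≈1) = NormOne⇒≡a^n (normOne N≈1)
    U⁰⇒≡a^n {z} (_ , inj₂ N≈-1) =
      let n , za≡a^n = NormOne⇒≡a^n (NormOne-*a {z} N≈-1) in n ℕ.+ ℕ.pred l , ^-divide n za≡a^n

theorem7 : ∀ {ℓ} (p : ℕ) → Prime p → 3 ≤ p →
    (d : ℤₚ p) → IsUnit p d → ¬ IsSquare p d →
    let open ℤₚ[√d] d in
    (a : 𝒪) (l : ℕ) (k : ℕ ⁺) → a ∈ U⁰ → HasOrderModP a l → ν (a ^ l - 1#) is k →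
    IsClosedSubgroupGeneratedBy ℓ a (closure (powers a))
    × (closure (powers a) ≐ ⋃[ i ∶ Fin l ] (coset (a ^ toℕ i) k ∩ U⁰))
    × (∀ (i j : Fin l) → i ≢ j → (coset (a ^ toℕ i) k ∩ U⁰) ⊥ (coset (a ^ toℕ j) k ∩ U⁰))
    × (l ≡ 2 ℕ.* (p ℕ.+ 1) → k ≡ [ 1 ] → closure (powers a) ≐ U⁰)
theorem7 p pp 3≤p d d-unit _ a l k a∈U⁰ order ν≡k =
    ⟨a⟩-isGenerated
  , (⟨a⟩⊆cosets k ν≡k , cosets⊆⟨a⟩ k ν≡k)
  , cosets-disjoint k ν≡k
  -- For `k = [ 1 ]` the density argument starts at precision one (`e` is 0), exactly what the
  -- congruence modulo `p` provides.
  , λ { l≡2[p+1] ≡.refl → ⟨a⟩⊆U⁰ , λ z∈U⁰ →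
          let n , z≡a^n = FullOrder.U⁰⇒≡a^n d-unit l≡2[p+1] z∈U⁰ in ≡a^n⇒∈⟨a⟩ 0 (ν⇒Exact 1 ν≡k) n z∈U⁰ z≡a^n }
  where open ClosureOfPowers p pp 3≤p d a l a∈U⁰ order
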